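{- For any class $\mathcal{H}$ of hypergraphs, if $\mathcal{H}$ has unbounded hypertree width and bounded fractional hypertree width, then $\mathcal{H}$ is exotic.
   Context: A class $\mathcal{H}$ of hypergraphs is exotic if for every integer $n\ge1$ there exist $H\in\mathcal{H}$ and a set $U\subseteq V(H)$ of $n$ vertices such that the induced subhypergraph $H[U]=(U,\{e\cap U: e\in E(H)\}\setminus\{\emptyset\})$ has at least $2^n-1$ distinct edges. A tree decomposition of $H$ is a tree $T$ with bags $B_u\subseteq V(H)$ such that each hyperedge lies in some bag and each vertex's bags form a connected subtree. A fractional edge cover of $X\subseteq V(H)$ is $\gamma:E(H)\to\mathbb{R}^+$ with $\sum_{e\ni v}\gamma(e)\ge1$ for all $v\in X$; $\rho^*_H(X)$ is the minimum total weight of such a cover. The fractional hypertree width $fhw(H)$ is the minimum over tree decompositions of $\max_u\rho^*_H(B_u)$. A hypertree decomposition of $H$ is a rooted tree $T$ with bags $B_u\subseteq V(H)$ and covers $\lambda_u\subseteq E(H)$ such that: each vertex's bags form a connected subtree; each hyperedge is contained in some bag; $B_u\subseteq\bigcup\lambda_u$; and $(\bigcup\lambda_u)\cap B(T_u)\subseteq B_u$, where $B(T_u)$ is the union of bags in the subtree rooted at $u$. Its width is $\max_u|\lambda_u|$ and the hypertree width $hw(H)$ is the minimum width over hypertree decompositions. A class has bounded width if some constant bounds the width of all its members. -}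

module Defs where

open import Data.Nat as ℕ using (ℕ; zero; suc; _^_; _∸_)
open import Data.Fin using (Fin; zero; suc; toℕ)
open import Data.Fin.Subset using (Subset; _∈_; _⊆_; _∩_; ∣_∣; ⊥)
open import Data.Vec using (lookup)
open import Data.Bool using (if_then_else_)
open import Data.Rational as ℚ using (ℚ; 0ℚ; 1ℚ)
open import Data.List using (List; length)
open import Data.List.Relation.Unary.All using (All)
open import Data.List.Relation.Unary.Unique.Propositional using (Unique)
open import Data.Product using (Σ; ∃; ∃-syntax; _×_)
open import Relation.Nullary using (¬_)
open import Relation.Binary.PropositionalEquality using (_≡_; _≢_)

record Hypergraph : Set where
  field
    nV   : ℕ
    nE   : ℕ
    edge : Fin nE → Subset nV
open Hypergraph public

Class : Set₁
Class = Hypergraph → Set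

IsInducedEdge : (H : Hypergraph) → Subset (nV H) → Subset (nV H) → Set
IsInducedEdge H U s = (s ≢ ⊥) × ∃[ e ] (s ≡ edge H e ∩ U)

HasAtLeastInducedEdges : (H : Hypergraph) → Subset (nV H) → ℕ → Set
HasAtLeastInducedEdges H U k =
  ∃[ L ] (Unique L × All (IsInducedEdge H U) L × k ℕ.≤ length L)

Exotic : Class → Set
Exotic 𝓗 = ∀ (n : ℕ) → 1 ℕ.≤ n →
  ∃[ H ] (𝓗 H × ∃[ U ] (∣ U ∣ ≡ n × HasAtLeastInducedEdges H U (2 ^ n ∸ 1)))

-- Trees: nodes Fin (suc size); node (suc i) has parent (par i), whose
-- index is at most i. Every finite tree, rooted at node zero, arises this way.

record Tree : Set where
  field
    size   : ℕ
    par    : Fin size → Fin (suc size)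
    par-lt : ∀ i → toℕ (par i) ℕ.≤ toℕ i
open Tree public

Node : Tree → Set
Node T = Fin (suc (size T))

ParentOf : (T : Tree) → Node T → Node T → Set
ParentOf T p c = ∃[ i ] (c ≡ suc i × p ≡ par T i)

Adj : (T : Tree) → Node T → Node T → Set
Adj T x y = ParentOf T x y Data.Sum.⊎ ParentOf T y x
  where import Data.Sum

data WalkIn (T : Tree) (S : Node T → Set) : Node T → Node T → Set where
  here : ∀ {x} → S x → WalkIn T S x x
  step : ∀ {x y z} → S x → Adj T x y → WalkIn T S y z → WalkIn T S x z

Connected : (T : Tree) → (Node T → Set) → Set
Connected T S = ∀ x y → S x → S y → WalkIn T S x y

data Desc (T : Tree) (u : Node T) : Node T → Set where
  self : Desc T u u
  down : ∀ {x d} → Desc T u x → ParentOf T x d → Desc T u d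

record TreeDecomposition (H : Hypergraph) : Set where
  field
    tree      : Tree
    bag       : Node tree → Subset (nV H)
    edge-bag  : ∀ e → ∃[ u ] (edge H e ⊆ bag u)
    connected : ∀ v → Connected tree (λ u → v ∈ bag u)
open TreeDecomposition public

sumℚ : (m : ℕ) → (Fin m → ℚ) → ℚ
sumℚ zero    f = 0ℚ
sumℚ (suc m) f = f zero ℚ.+ sumℚ m (λ i → f (suc i))

FracEdgeCover : (H : Hypergraph) → Subset (nV H) → (Fin (nE H) → ℚ) → Set
FracEdgeCover H X γ =
  (∀ e → 0ℚ ℚ.≤ γ e) ×
  (∀ v → v ∈ X →
     1ℚ ℚ.≤ sumℚ (nE H) (λ e → if lookup (edge H e) v then γ e else 0ℚ))

-- ρ*_H(X) ≤ c  (the minimum is attained, so this means some cover has weight ≤ c)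
ρ*≤ : (H : Hypergraph) → Subset (nV H) → ℚ → Set
ρ*≤ H X c = ∃[ γ ] (FracEdgeCover H X γ × sumℚ (nE H) γ ℚ.≤ c)

fhw≤ : Hypergraph → ℚ → Set
fhw≤ H c = ∃[ D ] (∀ (u : Node (tree {H} D)) → ρ*≤ H (bag D u) c)

BoundedFhw : Class → Set
BoundedFhw 𝓗 = ∃[ c ] (∀ H → 𝓗 H → fhw≤ H c)

record HypertreeDecomposition (H : Hypergraph) : Set where
  field
    tree      : Tree
    bag       : Node tree → Subset (nV H)
    cover     : Node tree → Subset (nE H)
    connected : ∀ v → Connected tree (λ u → v ∈ bag u)
    edge-bag  : ∀ e → ∃[ u ] (edge H e ⊆ bag u)
    bag-cov   : ∀ u v → v ∈ bag u → ∃[ e ] (e ∈ cover u × v ∈ edge H e)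
    special   : ∀ u v → (∃[ e ] (e ∈ cover u × v ∈ edge H e)) →
                (∃[ w ] (Desc tree u w × v ∈ bag w)) → v ∈ bag u

hw≤ : Hypergraph → ℕ → Set
hw≤ H k = ∃[ D ] (∀ u → ∣ HypertreeDecomposition.cover {H} D u ∣ ℕ.≤ k)

UnboundedHw : Class → Set
UnboundedHw 𝓗 = ∀ (k : ℕ) → ∃[ H ] (𝓗 H × ¬ hw≤ H k)

{-# OPTIONS --safe #-}
-- If no n-set of vertices of H is shattered by the edges, then fractional and integral covers of a
-- bag differ boundedly.  Suppose a bag of fractional cover number c has no cover by k edges.
-- Sample m blocks of t edges each from the fractional cover.  For every set I of blocks some
-- vertex v_I of the bag is missed by all blocks in I; a block outside I is independent of v_I and
-- misses it with probability at most (1 − 1/c)^t.  By a union bound over all I some sample realises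
-- all 2^m patterns on its blocks, so the m t edges have 2^m traces on vertices, more than the
-- Sauer–Shelah bound for dual VC dimension below 2^n, and dual shattering of 2^n edges shatters n vertices.
--
-- A tree decomposition with bags covered by k edges supplies, for each list M of edges, a node whose
-- bag splits M into parts of at most half its size.  Splitting recursively, with the at most 2k edges
-- that cover the boundary of the current piece and one further edge meeting it as M, gives a
-- hypertree decomposition of width at most 3k + 1; its bags contain every vertex of
-- their cover that is still in play, which is the special condition.
module Submission where

open import Defs
open import Algebra.Properties.CommutativeSemigroup using (interchange; x∙yz≈y∙xz; x∙yz≈yx∙z)
open import Data.Bool using (Bool; true; false; _∧_; _∨_; not; if_then_else_)
import Data.Bool.Properties as Bool
open import Data.Fin using (Fin; zero; suc; toℕ; splitAt; _↑ˡ_; _↑ʳ_; _≟_; finToFun; funToFin)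
open import Data.Fin.Properties
  using (any?; splitAt-↑ˡ; splitAt-↑ʳ; splitAt⁻¹-↑ˡ; splitAt⁻¹-↑ʳ; ↑ˡ-injective; ↑ʳ-injective;
         toℕ-↑ˡ; toℕ-↑ʳ; toℕ<n; finToFun-funToFin)
open import Data.Fin.Subset using (Subset; _∈_; _∉_; _⊆_; _∩_; _∪_; ∣_∣; ⊥; ⊤; ⁅_⁆)
open import Data.Fin.Subset.Properties
  using (anySubset?; _∈?_; ∉⊥; ∈⊤; ∣⊥∣≡0; x∈p∪q⁺; x∈p∪q⁻; x∈p∩q⁺; x∈p∩q⁻; x∈⁅x⁆; x∈⁅y⁆⇒x≡y; ∪-identityˡ; p⊂q⇒∣p∣<∣q∣)
open import Data.Integer as ℤ using (-[1+_])
import Data.Integer.Properties as ℤ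
open import Data.List as List
  using (List; []; _∷_; _++_; length; filter; replicate; allFin; cartesianProductWith)
open import Data.List.Membership.Propositional using (find; lose) renaming (_∈_ to _∈ˡ_)
open import Data.List.Membership.Propositional.Properties
  using (∈-cartesianProductWith⁺; ∈-allFin; ∈-tabulate⁺; ∈-filter⁺; ∈-++⁺ˡ; ∈-++⁺ʳ; ∈-++⁻)
open import Data.List.Properties using (length-++; length-map; length-tabulate)
open import Data.List.Relation.Unary.All as All using (All; []; _∷_)
import Data.List.Relation.Unary.All.Properties as All
open import Data.List.Relation.Unary.AllPairs using ([]; _∷_)
open import Data.List.Relation.Unary.Any as Any using (here; there)
open import Data.List.Relation.Unary.Unique.Propositional using (Unique)
import Data.List.Relation.Unary.Unique.Propositional.Properties as Unique
open import Data.Nat as ℕ using (ℕ; zero; suc; _+_; _*_; _∸_; _^_; _≤_; _<_; z≤n; s≤s; s≤s⁻¹; NonZero)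
open import Data.Nat.Properties hiding (_≟_)
open import Data.Nat.Solver using (module +-*-Solver)
open import Data.Product using (∃; _×_; _,_; proj₁; proj₂)
open import Data.Rational as ℚ using (ℚ; mkℚ; 0ℚ; 1ℚ; toℚᵘ)
import Data.Rational.Properties as ℚ
open import Data.Rational.Unnormalised as ℚᵘ using (ℚᵘ; mkℚᵘ; *≡*; *≤*) renaming (_≃_ to _≃ᵘ_)
import Data.Rational.Unnormalised.Properties as ℚᵘ
open import Data.Sum using (_⊎_; inj₁; inj₂; [_,_]′)
open import Data.Vec as Vec using (Vec; []; _∷_; lookup; _[_]≔_; tabulate; take; drop; concat; head; tail; toList)
open import Data.Vec.Properties
  using (lookup-map; map-cong; map-∘; map-concat; tabulate-cong; tabulate-∘; tabulate∘lookup;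
         lookup∘tabulate; lookup∘update; lookup-replicate; length-toList; ≡-dec; ∷-injective; []=⇒lookup; lookup⇒[]=)
open import Function using (_∘_; id)
import Relation.Binary.Reasoning.Setoid
open import Relation.Binary.PropositionalEquality
open import Relation.Nullary using (¬_; Dec; yes; no; contradiction; does)
open import Relation.Nullary.Decidable using (map′; dec-true; decidable-stable; ¬?; _×-dec_; _⊎-dec_)
open import Relation.Unary using (Decidable)
open +-*-Solver using (solve; _:+_; _:*_; _:=_; con)

private
  variable
    A A′ : Set
    m n p t : ℕ

  +-interchange : ∀ a b c d → (a + b) + (c + d) ≡ (a + c) + (b + d)
  +-interchange = interchange +-commutativeSemigroup

  module ≃ᵘ-Reasoning = Relation.Binary.Reasoning.Setoid ℚᵘ.≃-setoid

-- Finite sums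

∑ : List A → (A → ℕ) → ℕ
∑ []       f = 0
∑ (x ∷ xs) f = f x + ∑ xs f

∑-mono : ∀ (xs : List A) {f g} → (∀ x → f x ≤ g x) → ∑ xs f ≤ ∑ xs g
∑-mono []       le = z≤n
∑-mono (x ∷ xs) le = +-mono-≤ (le x) (∑-mono xs le)

∑-cong : ∀ (xs : List A) {f g} → (∀ x → f x ≡ g x) → ∑ xs f ≡ ∑ xs g
∑-cong []       eq = refl
∑-cong (x ∷ xs) eq = cong₂ _+_ (eq x) (∑-cong xs eq)

∑-+ : ∀ (xs : List A) f g → ∑ xs (λ x → f x + g x) ≡ ∑ xs f + ∑ xs g
∑-+ []       f g = refl
∑-+ (x ∷ xs) f g = trans (cong (f x + g x +_) (∑-+ xs f g)) (+-interchange (f x) (g x) _ _)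

∑-*ˡ : ∀ (xs : List A) k f → ∑ xs (λ x → k * f x) ≡ k * ∑ xs f
∑-*ˡ []       k f = sym (*-zeroʳ k)
∑-*ˡ (x ∷ xs) k f = trans (cong (k * f x +_) (∑-*ˡ xs k f)) (sym (*-distribˡ-+ k (f x) _))

∑-const : ∀ (xs : List A) k → ∑ xs (λ _ → k) ≡ length xs * k
∑-const []       k = refl
∑-const (x ∷ xs) k = cong (k +_) (∑-const xs k)

∑-swap : ∀ (xs : List A) (ys : List A′) (f : A → A′ → ℕ) →
         ∑ xs (λ x → ∑ ys (f x)) ≡ ∑ ys (λ y → ∑ xs (λ x → f x y))
∑-swap []       ys f = sym (trans (∑-const ys 0) (*-zeroʳ (length ys)))
∑-swap (x ∷ xs) ys f = trans (cong (∑ ys (f x) +_) (∑-swap xs ys f))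
                             (sym (∑-+ ys (f x) (λ y → ∑ xs (λ x → f x y))))

∑-++ : ∀ (xs ys : List A) f → ∑ (xs ++ ys) f ≡ ∑ xs f + ∑ ys f
∑-++ []       ys f = refl
∑-++ (x ∷ xs) ys f = trans (cong (f x +_) (∑-++ xs ys f)) (sym (+-assoc (f x) _ _))

∑-map : ∀ (g : A → A′) xs f → ∑ (List.map g xs) f ≡ ∑ xs (f ∘ g)
∑-map g []       f = refl
∑-map g (x ∷ xs) f = cong (f (g x) +_) (∑-map g xs f)

∑-member : ∀ {xs : List A} {x} f → x ∈ˡ xs → f x ≤ ∑ xs f
∑-member f (here refl) = m≤m+n _ _
∑-member f (there x∈)  = ≤-trans (∑-member f x∈) (m≤n+m _ _)

∑<length⇒zero : ∀ (xs : List A) f → ∑ xs f < length xs → ∃ λ x → f x ≡ 0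
∑<length⇒zero (x ∷ xs) f lt with f x in eq
... | zero  = x , eq
... | suc k = ∑<length⇒zero xs f (≤-trans (s≤s (m≤n+m _ k)) (s≤s⁻¹ lt))

tuples : List A → ∀ n → List (Vec A n)
tuples xs zero    = [] ∷ []
tuples xs (suc n) = cartesianProductWith _∷_ xs (tuples xs n)

∑-tuples : ∀ (xs : List A) n (f : Vec A (suc n) → ℕ) →
           ∑ (tuples xs (suc n)) f ≡ ∑ xs (λ x → ∑ (tuples xs n) (f ∘ (x ∷_)))
∑-tuples xs n f = go xs
  where
  ts = tuples xs n
  go : ∀ ys → ∑ (cartesianProductWith _∷_ ys ts) f ≡ ∑ ys (λ x → ∑ ts (f ∘ (x ∷_)))
  go []       = refl
  go (y ∷ ys) = trans (∑-++ (List.map (y ∷_) ts) _ f) (cong₂ _+_ (∑-map (y ∷_) ts f) (go ys))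

length-∑ : ∀ (xs : List A) → length xs ≡ ∑ xs (λ _ → 1)
length-∑ xs = sym (trans (∑-const xs 1) (*-identityʳ _))

length-tuples : ∀ (xs : List A) n → length (tuples xs n) ≡ length xs ^ n
length-tuples xs zero    = refl
length-tuples xs (suc n) = begin
  length (tuples xs (suc n))                 ≡⟨ length-∑ (tuples xs (suc n)) ⟩
  ∑ (tuples xs (suc n)) (λ _ → 1)            ≡⟨ ∑-tuples xs n (λ _ → 1) ⟩
  ∑ xs (λ _ → ∑ (tuples xs n) (λ _ → 1))     ≡⟨ ∑-const xs _ ⟩
  length xs * ∑ (tuples xs n) (λ _ → 1)      ≡⟨ cong (length xs *_) (trans (sym (length-∑ (tuples xs n))) (length-tuples xs n)) ⟩
  length xs ^ suc n                          ∎
  where open ≡-Reasoning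

∈-tuples : ∀ {xs : List A} → (∀ x → x ∈ˡ xs) → ∀ {n} (v : Vec A n) → v ∈ˡ tuples xs n
∈-tuples all []      = here refl
∈-tuples all (x ∷ v) = ∈-cartesianProductWith⁺ _∷_ (all x) (∈-tuples all v)

-- Fubini in the coordinate j.
∑-tuples-coordinate : ∀ (xs : List A) k (f : Vec A n → ℕ) j →
  (∀ v → k * ∑ xs (λ x → f (v [ j ]≔ x)) ≤ length xs) →
  k * ∑ (tuples xs n) f ≤ length xs ^ n
∑-tuples-coordinate {n = suc n} xs k f zero le = begin
  k * ∑ (tuples xs (suc n)) f                            ≡⟨ cong (k *_) (trans (∑-tuples xs n f) (∑-swap xs (tuples xs n) (λ x v → f (x ∷ v)))) ⟩
  k * ∑ (tuples xs n) (λ v → ∑ xs (λ x → f (x ∷ v)))     ≡⟨ ∑-*ˡ (tuples xs n) k _ ⟨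
  ∑ (tuples xs n) (λ v → k * ∑ xs (λ x → f (x ∷ v)))     ≤⟨ bound xs le ⟩
  ∑ (tuples xs n) (λ _ → length xs)                      ≡⟨ ∑-const (tuples xs n) _ ⟩
  length (tuples xs n) * length xs                       ≡⟨ cong (_* length xs) (length-tuples xs n) ⟩
  length xs ^ n * length xs                              ≡⟨ *-comm _ (length xs) ⟩
  length xs ^ suc n                                      ∎
  where
  open ≤-Reasoning
  bound : ∀ ys → (∀ v → k * ∑ ys (λ x → f (v [ zero ]≔ x)) ≤ length ys) →
          ∑ (tuples ys n) (λ v → k * ∑ ys (λ x → f (x ∷ v))) ≤ ∑ (tuples ys n) (λ _ → length ys)
  -- The hypothesis speaks of vectors whose coordinate zero is overwritten, so some element must
  -- first fill that place. An empty list offers none, but then the inner sums vanish.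
  bound []       le = ∑-mono (tuples [] n) λ v → ≤-reflexive (*-zeroʳ k)
  bound (y ∷ ys) le = ∑-mono (tuples (y ∷ ys) n) λ v → le (y ∷ v)
∑-tuples-coordinate {n = suc n} xs k f (suc j) le = begin
  k * ∑ (tuples xs (suc n)) f                            ≡⟨ cong (k *_) (∑-tuples xs n f) ⟩
  k * ∑ xs (λ x → ∑ (tuples xs n) (λ v → f (x ∷ v)))     ≡⟨ ∑-*ˡ xs k _ ⟨
  ∑ xs (λ x → k * ∑ (tuples xs n) (λ v → f (x ∷ v)))     ≤⟨ ∑-mono xs (λ x → ∑-tuples-coordinate xs k (λ v → f (x ∷ v)) j (λ v → le (x ∷ v))) ⟩
  ∑ xs (λ _ → length xs ^ n)                             ≡⟨ ∑-const xs _ ⟩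
  length xs ^ suc n                                      ∎
  where open ≤-Reasoning

-- Shattering

bit : Bool → ℕ
bit b = if b then 1 else 0

count : (Vec Bool p → Bool) → ℕ
count {zero}  f = bit (f [])
count {suc p} f = count (f ∘ (false ∷_)) + count (f ∘ (true ∷_))

count-modular : ∀ (f g : Vec Bool p → Bool) →
  count f + count g ≡ count (λ x → f x ∨ g x) + count (λ x → f x ∧ g x)
count-modular {zero}  f g with f [] | g []
... | false | false = refl
... | false | true  = refl
... | true  | false = refl
... | true  | true  = refl
count-modular {suc p} f g = begin
  (count f₀ + count f₁) + (count g₀ + count g₁)   ≡⟨ +-interchange (count f₀) _ _ _ ⟩
  (count f₀ + count g₀) + (count f₁ + count g₁)   ≡⟨ cong₂ _+_ (count-modular f₀ g₀) (count-modular f₁ g₁) ⟩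
  _                                               ≡⟨ +-interchange (count (λ x → f₀ x ∨ g₀ x)) _ _ _ ⟩
  _                                               ∎
  where
  open ≡-Reasoning
  f₀ f₁ g₀ g₁ : Vec Bool p → Bool
  f₀ = f ∘ (false ∷_)
  f₁ = f ∘ (true ∷_)
  g₀ = g ∘ (false ∷_)
  g₁ = g ∘ (true ∷_)

count-pos : ∀ (f : Vec Bool p → Bool) x → f x ≡ true → 1 ≤ count f
count-pos f []          eq rewrite eq = ≤-refl
count-pos f (false ∷ x) eq = ≤-trans (count-pos (f ∘ (false ∷_)) x eq) (m≤m+n _ _)
count-pos f (true  ∷ x) eq = ≤-trans (count-pos (f ∘ (true ∷_)) x eq) (m≤n+m _ _)

count-pos⁻¹ : ∀ (f : Vec Bool p → Bool) → 1 ≤ count f → ∃ λ x → f x ≡ true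
count-pos⁻¹ {zero}  f lt with f [] in eq
... | true = [] , eq
count-pos⁻¹ {suc p} f lt with count (f ∘ (false ∷_)) in eq
... | zero  = let x , fx = count-pos⁻¹ (f ∘ (true ∷_)) lt in true ∷ x , fx
... | suc _ = let x , fx = count-pos⁻¹ (f ∘ (false ∷_)) (subst (1 ≤_) (sym eq) (s≤s z≤n)) in false ∷ x , fx

Shatters : (Vec Bool p → Bool) → ∀ {d} → Vec (Fin p) d → Set
Shatters f ι = ∀ q → ∃ λ x → f x ≡ true × Vec.map (lookup x) ι ≡ q

map-lookup-suc : ∀ b (x : Vec Bool p) {d} (ι : Vec (Fin p) d) →
                 Vec.map (lookup (b ∷ x)) (Vec.map suc ι) ≡ Vec.map (lookup x) ι
map-lookup-suc b x ι = sym (map-∘ (lookup (b ∷ x)) suc ι)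

-- Split by the first coordinate: the union and the intersection of the two halves have together the
-- size of `f`. Either the union is large enough to shatter `suc d` later coordinates, or the
-- intersection is large enough to shatter `d` of them, and the first coordinate joins these. The
-- bound `suc p ^ d` stands in for the sum of binomial coefficients.
sauer-shelah : ∀ d (f : Vec Bool p → Bool) → suc p ^ d < count f →
               ∃ λ (ι : Vec (Fin p) d) → Shatters f ι
sauer-shelah zero f lt =
  let x , fx = count-pos⁻¹ f (≤-trans (s≤s z≤n) lt) in [] , λ { [] → x , fx , refl }
sauer-shelah {zero} (suc d) f lt =
  contradiction (≤-trans (s≤s (≤-reflexive (sym (^-zeroˡ (suc d))))) lt) (small (f []))
  where
  small : ∀ b → ¬ 2 ≤ bit b
  small true (s≤s ())
sauer-shelah {suc p} (suc d) f lt with suc p ^ suc d <? count (λ x → f (false ∷ x) ∨ f (true ∷ x))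
... | yes lt∨ =
  let ι , sh = sauer-shelah (suc d) _ lt∨ in
  Vec.map suc ι , λ q → let x , fx , eq = sh q ; b , fbx = ∨-split x fx in
    b ∷ x , fbx , trans (map-lookup-suc b x ι) eq
  where
  ∨-split : ∀ x → f (false ∷ x) ∨ f (true ∷ x) ≡ true → ∃ λ b → f (b ∷ x) ≡ true
  ∨-split x eq with f (false ∷ x) in eq₀
  ... | true  = false , eq₀
  ... | false = true , eq
... | no ¬lt∨ =
  let ι , sh = sauer-shelah d _ lt∧ in
  zero ∷ Vec.map suc ι , λ { (b ∷ q) → let x , fx , eq = sh q in
    b ∷ x , ∧-split b x fx , cong (b ∷_) (trans (map-lookup-suc b x ι) eq) }
  where
  c∨ = count (λ x → f (false ∷ x) ∨ f (true ∷ x))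
  c∧ = count (λ x → f (false ∷ x) ∧ f (true ∷ x))
  ∧-split : ∀ b x → f (false ∷ x) ∧ f (true ∷ x) ≡ true → f (b ∷ x) ≡ true
  ∧-split b x eq with f (false ∷ x) in eq₀ | f (true ∷ x) in eq₁
  ∧-split false x eq | true | true = eq₀
  ∧-split true  x eq | true | true = eq₁
  -- The left side is by computation `suc (suc p) * suc p ^ d`.
  pow-step : suc p ^ d + suc p ^ suc d ≤ suc (suc p) ^ suc d
  pow-step = *-monoʳ-≤ (suc (suc p)) (^-monoˡ-≤ d (n≤1+n (suc p)))
  lt∧ : suc p ^ d < c∧
  lt∧ = +-cancelˡ-< c∨ _ _ (begin-strict
    c∨ + suc p ^ d                   ≤⟨ +-monoˡ-≤ _ (≮⇒≥ ¬lt∨) ⟩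
    suc p ^ suc d + suc p ^ d        ≡⟨ +-comm (suc p ^ suc d) _ ⟩
    suc p ^ d + suc p ^ suc d        ≤⟨ pow-step ⟩
    suc (suc p) ^ suc d              <⟨ lt ⟩
    count f                          ≡⟨ count-modular (f ∘ (false ∷_)) _ ⟩
    c∨ + c∧                          ∎)
    where open ≤-Reasoning

count-split : ∀ (f h : Vec Bool p → Bool) →
  count f ≡ count (λ x → f x ∧ h x) + count (λ x → f x ∧ not (h x))
count-split {zero} f h with f [] | h []
... | false | _     = refl
... | true  | false = refl
... | true  | true  = refl
count-split {suc p} f h = trans
  (cong₂ _+_ (count-split (f ∘ (false ∷_)) (h ∘ (false ∷_))) (count-split (f ∘ (true ∷_)) (h ∘ (true ∷_))))
  (+-interchange (count {p} _) _ _ _)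

-- Splitting by the first decoded bit gives two disjoint subfamilies, each still decoding onto all
-- patterns of the remaining bits.
2^≤count : ∀ m (f : Vec Bool p → Bool) (decode : Vec Bool p → Vec Bool m) →
  (∀ q → ∃ λ x → f x ≡ true × decode x ≡ q) → 2 ^ m ≤ count f
2^≤count zero    f decode onto = let x , fx , _ = onto [] in count-pos f x fx
2^≤count (suc m) f decode onto = begin
  2 ^ m + (2 ^ m + 0)                                  ≡⟨ cong (2 ^ m +_) (+-identityʳ _) ⟩
  2 ^ m + 2 ^ m                                        ≤⟨ +-mono-≤ (half true id refl) (half false not refl) ⟩
  count (λ x → f x ∧ h x) + count (λ x → f x ∧ not (h x)) ≡⟨ count-split f h ⟨
  count f                                              ∎
  where
  open ≤-Reasoning
  h = head ∘ decode
  half : ∀ b (g : Bool → Bool) → g b ≡ true → 2 ^ m ≤ count (λ x → f x ∧ g (h x))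
  half b g gb = 2^≤count m _ (tail ∘ decode) λ q →
    let x , fx , eq = onto (b ∷ q) in
    x , cong₂ _∧_ fx (trans (cong (g ∘ head) eq) gb) , cong tail eq

-- Growth estimates

^-distribʳ-* : ∀ a b n → (a * b) ^ n ≡ a ^ n * b ^ n
^-distribʳ-* a b zero    = refl
^-distribʳ-* a b (suc n) = trans (cong (a * b *_) (^-distribʳ-* a b n)) ([m*n]*[o*p]≡[m*o]*[n*p] a b (a ^ n) (b ^ n))

n<2^n : ∀ n → n < 2 ^ n
n<2^n zero    = s≤s z≤n
n<2^n (suc n) = begin-strict
  suc n               <⟨ s≤s (n<2^n n) ⟩
  1 + 2 ^ n           ≤⟨ +-monoˡ-≤ (2 ^ n) (m^n>0 2 n) ⟩
  2 ^ n + 2 ^ n       ≡⟨ cong (2 ^ n +_) (+-identityʳ _) ⟨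
  2 ^ suc n           ∎
  where open ≤-Reasoning

-- The first two terms of the binomial expansion of (μ + 1)^(j + 1).
bernoulli : ∀ μ j → μ ^ suc j + suc j * μ ^ j ≤ suc μ ^ suc j
bernoulli μ zero    = ≤-reflexive (+-comm (μ * 1) 1)
bernoulli μ (suc j) = begin
  μ ^ suc (suc j) + (μ ^ suc j + suc j * μ ^ suc j)        ≤⟨ m≤m+n _ (suc j * μ ^ j) ⟩
  μ ^ suc (suc j) + (μ ^ suc j + suc j * μ ^ suc j) + suc j * μ ^ j
    ≡⟨ solve 3 (λ u v w → u :* (u :* v) :+ (u :* v :+ w :* (u :* v)) :+ w :* v
                       := (u :* v :+ w :* v) :+ u :* (u :* v :+ w :* v)) refl μ (μ ^ j) (suc j) ⟩
  suc μ * (μ ^ suc j + suc j * μ ^ j)                      ≤⟨ *-monoʳ-≤ (suc μ) (bernoulli μ j) ⟩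
  suc μ ^ suc (suc j)                                      ∎
  where open ≤-Reasoning

-- With M = μ + 1 this is (1 - 1/M)^M ≤ 1/2. At j = μ the second term of `bernoulli`, (μ + 1) μ^μ,
-- is at least μ^(μ + 1).
2*μ^M≤M^M : ∀ μ → 2 * μ ^ suc μ ≤ suc μ ^ suc μ
2*μ^M≤M^M μ = ≤-trans (+-monoʳ-≤ (μ ^ suc μ) (≤-trans (≤-reflexive (+-identityʳ _)) (m≤n+m _ (μ ^ μ)))) (bernoulli μ μ)

geometric-decay : ∀ μ s → 2 ^ s * μ ^ (suc μ * s) ≤ suc μ ^ (suc μ * s)
geometric-decay μ s = begin
  2 ^ s * μ ^ (suc μ * s)       ≡⟨ cong (2 ^ s *_) (^-*-assoc μ (suc μ) s) ⟨
  2 ^ s * (μ ^ suc μ) ^ s       ≡⟨ ^-distribʳ-* 2 (μ ^ suc μ) s ⟨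
  (2 * μ ^ suc μ) ^ s           ≤⟨ ^-monoˡ-≤ s (2*μ^M≤M^M μ) ⟩
  (suc μ ^ suc μ) ^ s           ≡⟨ ^-*-assoc (suc μ) (suc μ) s ⟩
  suc μ ^ (suc μ * s)           ∎
  where open ≤-Reasoning

-- The union bound ranges over m 2^m pairs of a pattern and a block, each failing with probability
-- at most 2^(-2m).
m*2^m<2^2m : ∀ m → m * 2 ^ m < 2 ^ (2 * m)
m*2^m<2^2m m = begin-strict
  m * 2 ^ m         <⟨ *-monoˡ-< (2 ^ m) {{m^n≢0 2 m}} (n<2^n m) ⟩
  2 ^ m * 2 ^ m     ≡⟨ ^-distribˡ-+-* 2 m m ⟨
  2 ^ (m + m)       ≡⟨ cong (λ z → 2 ^ (m + z)) (+-identityʳ m) ⟨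
  2 ^ (2 * m)       ∎
  where open ≤-Reasoning

5n≤2^n : ∀ x → 5 * (5 + x) ≤ 2 ^ (5 + x)
5n≤2^n x = begin
  5 * (5 + x)             ≡⟨ *-distribˡ-+ 5 5 x ⟩
  25 + 5 * x              ≤⟨ +-mono-≤ (m≤m+n 25 7) (*-monoˡ-≤ x (m≤m+n 5 27)) ⟩
  32 + 32 * x             ≡⟨ *-suc 32 x ⟨
  32 * suc x              ≤⟨ *-monoʳ-≤ 32 (n<2^n x) ⟩
  32 * 2 ^ x              ≡⟨ ^-distribˡ-+-* 2 5 x ⟨
  2 ^ (5 + x)             ∎
  where open ≤-Reasoning

polynomial<exponential : ∀ c d → ∃ λ m → suc (c * (m * m)) ^ d < 2 ^ m
polynomial<exponential c d = 2 ^ (i + i) , (begin-strict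
  suc (c * (2 ^ (i + i) * 2 ^ (i + i))) ^ d    ≡⟨ cong (λ z → suc (c * z) ^ d) (^-distribˡ-+-* 2 (i + i) (i + i)) ⟨
  suc (c * 2 ^ e) ^ d                          ≤⟨ ^-monoˡ-≤ d step₁ ⟩
  (2 ^ suc (c + e)) ^ d                        ≡⟨ ^-*-assoc 2 (suc (c + e)) d ⟩
  2 ^ (suc (c + e) * d)                        <⟨ ^-monoʳ-< 2 (s≤s (s≤s z≤n)) step₂ ⟩
  2 ^ (2 ^ (i + i))                            ∎)
  where
  open ≤-Reasoning
  -- The witness is m = 2^(2i). Then 1 + c m² is at most 2^(c + 4i + 1), and c + 4i + 1 ≤ 5i ≤ 2^i
  -- together with d < 2^i keeps the total exponent below m. The summand 5 is where 5i ≤ 2^i starts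
  -- to hold for good.
  i = 5 + (c + d)
  e = (i + i) + (i + i)
  step₁ : suc (c * 2 ^ e) ≤ 2 ^ suc (c + e)
  step₁ = begin
    suc (c * 2 ^ e)               ≤⟨ +-monoˡ-≤ (c * 2 ^ e) (m^n>0 2 e) ⟩
    suc c * 2 ^ e                 ≤⟨ *-monoˡ-≤ (2 ^ e) (n<2^n c) ⟩
    2 ^ c * 2 ^ e                 ≡⟨ ^-distribˡ-+-* 2 c e ⟨
    2 ^ (c + e)                   ≤⟨ ^-monoʳ-≤ 2 (n≤1+n (c + e)) ⟩
    2 ^ suc (c + e)               ∎
  c<i : suc c ≤ i
  c<i = s≤s (≤-trans (m≤m+n c d) (m≤n+m (c + d) 4))
  d<2^i : d < 2 ^ i
  d<2^i = ≤-<-trans (≤-trans (m≤n+m d c) (m≤n+m (c + d) 5)) (n<2^n i)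
  step₂ : suc (c + e) * d < 2 ^ (i + i)
  step₂ = begin-strict
    suc (c + e) * d               ≤⟨ *-monoˡ-≤ d (+-monoˡ-≤ e c<i) ⟩
    (i + e) * d                   ≡⟨ cong (_* d) (cong (i +_) (trans (+-assoc i i (i + i)) (cong (λ z → i + (i + (i + z))) (sym (+-identityʳ i))))) ⟩
    (5 * i) * d                   ≤⟨ *-monoˡ-≤ d (5n≤2^n (c + d)) ⟩
    2 ^ i * d                     <⟨ *-monoʳ-< (2 ^ i) {{m^n≢0 2 i}} d<2^i ⟩
    2 ^ i * 2 ^ i                 ≡⟨ ^-distribˡ-+-* 2 i i ⟨
    2 ^ (i + i)                   ∎

-- Blocks of edges

take-++ : ∀ (xs : Vec A n) (ys : Vec A p) → take n (xs Vec.++ ys) ≡ xs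
take-++ []       ys = refl
take-++ (x ∷ xs) ys = cong (x ∷_) (take-++ xs ys)

drop-++ : ∀ (xs : Vec A n) (ys : Vec A p) → drop n (xs Vec.++ ys) ≡ ys
drop-++ []       ys = refl
drop-++ (x ∷ xs) ys = drop-++ xs ys

select : Vec Bool m → Vec (Vec A t) m → List A
select []          []       = []
select (true  ∷ q) (b ∷ bs) = toList b ++ select q bs
select (false ∷ q) (b ∷ bs) = select q bs

length-select : ∀ (q : Vec Bool m) (bs : Vec (Vec A t) m) → length (select q bs) ≤ m * t
length-select []          []       = z≤n
length-select {t = t} (true  ∷ q) (b ∷ bs) = begin
  length (toList b ++ select q bs)           ≡⟨ length-++ (toList b) ⟩
  length (toList b) + length (select q bs)   ≡⟨ cong (_+ length (select q bs)) (length-toList b) ⟩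
  t + length (select q bs)                   ≤⟨ +-monoʳ-≤ t (length-select q bs) ⟩
  _                                          ∎
  where open ≤-Reasoning
length-select {t = t} (false ∷ q) (b ∷ bs) = ≤-trans (length-select q bs) (m≤n+m _ t)

select-update : ∀ (q : Vec Bool m) (bs : Vec (Vec A t) m) j b → lookup q j ≡ false →
                select q (bs [ j ]≔ b) ≡ select q bs
select-update (true  ∷ q) (_ ∷ bs) (suc j) b eq = cong (toList _ ++_) (select-update q bs j b eq)
select-update (false ∷ q) (_ ∷ bs) zero    b eq = refl
select-update (false ∷ q) (_ ∷ bs) (suc j) b eq = select-update q bs j b eq

∈-select : ∀ (q : Vec Bool m) (bs : Vec (Vec A t) m) j → lookup q j ≡ true →
           ∀ {x} → x ∈ˡ toList (lookup bs j) → x ∈ˡ select q bs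
∈-select (true  ∷ q) (b ∷ bs) zero    eq x∈ = ∈-++⁺ˡ x∈
∈-select (true  ∷ q) (b ∷ bs) (suc j) eq x∈ = ∈-++⁺ʳ (toList b) (∈-select q bs j eq x∈)
∈-select (false ∷ q) (b ∷ bs) (suc j) eq x∈ = ∈-select q bs j eq x∈

allFalse : Vec Bool t → Bool
allFalse []      = true
allFalse (b ∷ x) = not b ∧ allFalse x

allFalse-map : ∀ (f : A → Bool) (b : Vec A t) → (∀ {e} → e ∈ˡ toList b → f e ≡ false) →
               allFalse (Vec.map f b) ≡ true
allFalse-map f []      all = refl
allFalse-map f (e ∷ b) all = cong₂ _∧_ (cong not (all (here refl))) (allFalse-map f b (all ∘ there))

decode : ∀ m {t} → Vec Bool (m * t) → Vec Bool m
decode zero        x = []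
decode (suc m) {t} x = allFalse (take t x) ∷ decode m (drop t x)

decode-concat : ∀ (xs : Vec (Vec Bool t) m) → decode m (concat xs) ≡ Vec.map allFalse xs
decode-concat []       = refl
decode-concat (x ∷ xs) = cong₂ _∷_ (cong allFalse (take-++ x _))
                                   (trans (cong (decode _) (drop-++ x _)) (decode-concat xs))

bools : List Bool
bools = false ∷ true ∷ []

∈-bools : ∀ b → b ∈ˡ bools
∈-bools false = here refl
∈-bools true  = there (here refl)

-- Sampling blocks of edges until every pattern is realised

module _ {E V : Set} (inc : E → V → Bool) where

  trace : Vec E p → V → Vec Bool p
  trace es v = Vec.map (λ e → inc e v) es

  missed : V → Vec E t → Bool
  missed v b = allFalse (trace b v)

  hits misses : List E → V → ℕ
  hits   Ω v = ∑ Ω (λ e → bit (inc e v))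
  misses Ω v = ∑ Ω (λ e → bit (not (inc e v)))

  hits+misses : ∀ Ω v → hits Ω v + misses Ω v ≡ length Ω
  hits+misses Ω v = trans (sym (∑-+ Ω _ _)) (trans (∑-cong Ω (λ e → one (inc e v))) (sym (length-∑ Ω)))
    where
    one : ∀ b → bit b + bit (not b) ≡ 1
    one false = refl
    one true  = refl

  ∑-missed : ∀ Ω v t → ∑ (tuples Ω t) (bit ∘ missed v) ≡ misses Ω v ^ t
  ∑-missed Ω v zero    = refl
  ∑-missed Ω v (suc t) = begin
    ∑ (tuples Ω (suc t)) (bit ∘ missed v)
      ≡⟨ ∑-tuples Ω t _ ⟩
    ∑ Ω (λ e → ∑ (tuples Ω t) (λ b → bit (not (inc e v) ∧ missed v b)))
      ≡⟨ ∑-cong Ω (λ e → trans (∑-cong (tuples Ω t) (λ b → bit-∧ (not (inc e v)) (missed v b)))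
                                (trans (∑-*ˡ (tuples Ω t) (bit (not (inc e v))) (bit ∘ missed v)) (*-comm (bit (not (inc e v))) (∑ (tuples Ω t) (bit ∘ missed v))))) ⟩
    ∑ Ω (λ e → ∑ (tuples Ω t) (bit ∘ missed v) * bit (not (inc e v)))
      ≡⟨ ∑-*ˡ Ω (∑ (tuples Ω t) (bit ∘ missed v)) (λ e → bit (not (inc e v))) ⟩
    ∑ (tuples Ω t) (bit ∘ missed v) * misses Ω v
      ≡⟨ cong (_* misses Ω v) (∑-missed Ω v t) ⟩
    misses Ω v ^ t * misses Ω v
      ≡⟨ *-comm _ (misses Ω v) ⟩
    misses Ω v ^ suc t ∎
    where
    open ≡-Reasoning
    bit-∧ : ∀ a b → bit (a ∧ b) ≡ bit a * bit b
    bit-∧ false b = refl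
    bit-∧ true  b = sym (+-identityʳ _)

  module _ (Ω : List E) (μ : ℕ) (X : V → Set)
           (heavy : ∀ v → X v → length Ω ≤ suc μ * hits Ω v) where

    -- `Ω` lists edges with repetition, and a uniform draw from it imitates the fractional cover. By
    -- `heavy` a draw hits v with probability at least 1/(μ + 1).
    misses≤ : ∀ v → X v → suc μ * misses Ω v ≤ μ * length Ω
    misses≤ v v∈X = +-cancelˡ-≤ (length Ω) _ _ (begin
      length Ω + suc μ * misses Ω v               ≤⟨ +-monoˡ-≤ _ (heavy v v∈X) ⟩
      suc μ * hits Ω v + suc μ * misses Ω v       ≡⟨ *-distribˡ-+ (suc μ) (hits Ω v) _ ⟨
      suc μ * (hits Ω v + misses Ω v)             ≡⟨ cong (suc μ *_) (hits+misses Ω v) ⟩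
      length Ω + μ * length Ω                     ∎)
      where open ≤-Reasoning

    -- A block of (μ + 1) 2m draws misses v with probability at most 2^(-2m), by `geometric-decay`.
    -- The factor `suc (m * 2 ^ m)` exceeds the number of bad events by one, which leaves the union
    -- bound a strict gap.
    few-missed : ∀ m → let τ = suc μ * (2 * m) in ∀ v → X v →
                 suc (m * 2 ^ m) * ∑ (tuples Ω τ) (bit ∘ missed v) ≤ length (tuples Ω τ)
    few-missed m v v∈X = *-cancelˡ-≤ (suc μ ^ τ) {{m^n≢0 (suc μ) τ}} (begin
      suc μ ^ τ * (K * ∑ (tuples Ω τ) (bit ∘ missed v))   ≡⟨ cong (λ z → suc μ ^ τ * (K * z)) (∑-missed Ω v τ) ⟩
      suc μ ^ τ * (K * misses Ω v ^ τ)                    ≡⟨ x∙yz≈y∙xz *-commutativeSemigroup (suc μ ^ τ) K _ ⟩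
      K * (suc μ ^ τ * misses Ω v ^ τ)                    ≡⟨ cong (K *_) (^-distribʳ-* (suc μ) (misses Ω v) τ) ⟨
      K * (suc μ * misses Ω v) ^ τ                        ≤⟨ *-mono-≤ (m*2^m<2^2m m) (^-monoˡ-≤ τ (misses≤ v v∈X)) ⟩
      2 ^ (2 * m) * (μ * W) ^ τ                           ≡⟨ cong (2 ^ (2 * m) *_) (^-distribʳ-* μ W τ) ⟩
      2 ^ (2 * m) * (μ ^ τ * W ^ τ)                       ≡⟨ *-assoc (2 ^ (2 * m)) _ _ ⟨
      2 ^ (2 * m) * μ ^ τ * W ^ τ                         ≤⟨ *-monoˡ-≤ (W ^ τ) (geometric-decay μ (2 * m)) ⟩
      suc μ ^ τ * W ^ τ                                   ≡⟨ cong (suc μ ^ τ *_) (length-tuples Ω τ) ⟨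
      suc μ ^ τ * length (tuples Ω τ)                     ∎)
      where
      open ≤-Reasoning
      τ = suc μ * (2 * m)
      K = suc (m * 2 ^ m)
      W = length Ω

    module _ (nonempty : 0 < length Ω) (m : ℕ)
             (uncovered : ∀ S → length S ≤ m * (suc μ * (2 * m)) → ∃ λ v → X v × ∀ {e} → e ∈ˡ S → inc e v ≡ false) where

      private
        τ K N : ℕ
        τ = suc μ * (2 * m)
        K = suc (m * 2 ^ m)
        N = length (tuples Ω τ)

      vertex : Vec Bool m → Vec (Vec E τ) m → V
      vertex q bs = proj₁ (uncovered (select q bs) (length-select q bs))

      vertex∈X : ∀ q bs → X (vertex q bs)
      vertex∈X q bs = proj₁ (proj₂ (uncovered (select q bs) (length-select q bs)))

      vertex-misses : ∀ q bs j → lookup q j ≡ true → missed (vertex q bs) (lookup bs j) ≡ true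
      vertex-misses q bs j eq = allFalse-map _ (lookup bs j) λ e∈ →
        proj₂ (proj₂ (uncovered (select q bs) (length-select q bs))) (∈-select q bs j eq e∈)

      -- The independence behind the union bound: the vertex chosen for q depends on the selected
      -- blocks only, so resampling another block leaves it fixed.
      vertex-update : ∀ q bs j b → lookup q j ≡ false → vertex q (bs [ j ]≔ b) ≡ vertex q bs
      vertex-update q bs j b eq = same (select-update q bs j b eq)
        where
        same : ∀ {S S'} {l : length S ≤ m * τ} {l' : length S' ≤ m * τ} → S ≡ S' →
               proj₁ (uncovered S l) ≡ proj₁ (uncovered S' l')
        same {S} refl = cong (λ l → proj₁ (uncovered S l)) (≤-irrelevant _ _)

      -- The bad event that block j lies outside the pattern q and is missed all the same. If none
      -- occurs, the chosen vertex misses exactly the blocks in q.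
      spoilt : Vec Bool m → Fin m → Vec (Vec E τ) m → ℕ
      spoilt q j bs = bit (not (lookup q j) ∧ missed (vertex q bs) (lookup bs j))

      -- Fix every block except the j-th. For j outside q the vertex is then constant, and
      -- `few-missed` bounds the share of choices for block j that miss it.
      ∑-spoilt : ∀ q j → K * ∑ (tuples (tuples Ω τ) m) (spoilt q j) ≤ N ^ m
      ∑-spoilt q j = ∑-tuples-coordinate (tuples Ω τ) K (spoilt q j) j one-coordinate
        where
        open ≤-Reasoning
        one-coordinate : ∀ bs → K * ∑ (tuples Ω τ) (λ b → spoilt q j (bs [ j ]≔ b)) ≤ N
        one-coordinate bs with lookup q j in eq
        ... | true  = ≤-trans (≤-reflexive (trans (cong (K *_) (trans (∑-const (tuples Ω τ) 0) (*-zeroʳ N))) (*-zeroʳ K))) z≤n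
        ... | false = begin
          K * ∑ (tuples Ω τ) (λ b → bit (missed (vertex q (bs [ j ]≔ b)) (lookup (bs [ j ]≔ b) j)))
            ≡⟨ cong (K *_) (∑-cong (tuples Ω τ) λ b →
                 cong₂ (λ v c → bit (missed v c)) (vertex-update q bs j b eq) (lookup∘update j bs b)) ⟩
          K * ∑ (tuples Ω τ) (bit ∘ missed (vertex q bs))
            ≤⟨ few-missed m (vertex q bs) (vertex∈X q bs) ⟩
          N ∎

      spoilage : Vec (Vec E τ) m → ℕ
      spoilage bs = ∑ (tuples bools m) (λ q → ∑ (allFin m) (λ j → spoilt q j bs))

      ∑-spoilage : K * ∑ (tuples (tuples Ω τ) m) spoilage ≤ (m * 2 ^ m) * N ^ m
      ∑-spoilage = begin
        K * ∑ Bs spoilage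
          ≡⟨ cong (K *_) (trans (∑-swap Bs Qs (λ bs q → ∑ Js (λ j → spoilt q j bs)))
                                (∑-cong Qs λ q → ∑-swap Bs Js (λ bs j → spoilt q j bs))) ⟩
        K * ∑ Qs (λ q → ∑ Js (λ j → ∑ Bs (spoilt q j)))
          ≡⟨ trans (∑-cong Qs (λ q → ∑-*ˡ Js K _)) (∑-*ˡ Qs K _) ⟨
        ∑ Qs (λ q → ∑ Js (λ j → K * ∑ Bs (spoilt q j)))
          ≤⟨ ∑-mono Qs (λ q → ∑-mono Js (λ j → ∑-spoilt q j)) ⟩
        ∑ Qs (λ q → ∑ Js (λ j → N ^ m))
          ≡⟨ trans (∑-cong Qs (λ q → ∑-const Js _)) (∑-const Qs _) ⟩
        length Qs * (length Js * N ^ m)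
          ≡⟨ cong₂ (λ a b → a * (b * N ^ m)) (length-tuples bools m) (length-tabulate {n = m} id) ⟩
        2 ^ m * (m * N ^ m)
          ≡⟨ x∙yz≈yx∙z *-commutativeSemigroup (2 ^ m) m (N ^ m) ⟩
        (m * 2 ^ m) * N ^ m ∎
        where
        open ≤-Reasoning
        Bs = tuples (tuples Ω τ) m
        Qs = tuples bools m
        Js = allFin m

      -- Averaging: there are fewer bad events in total than samples, so some sample has none. A
      -- nonempty `Ω` makes the number of samples positive and the inequality strict.
      unspoilt : ∃ λ bs → spoilage bs ≡ 0
      unspoilt = ∑<length⇒zero (tuples (tuples Ω τ) m) spoilage
        (subst (∑ (tuples (tuples Ω τ) m) spoilage <_) (sym (length-tuples (tuples Ω τ) m))
          (*-cancelˡ-< K _ _ (≤-<-trans ∑-spoilage (+-monoˡ-< ((m * 2 ^ m) * N ^ m) N^m>0))))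
        where
        N>0 : NonZero N
        N>0 = subst NonZero (sym (length-tuples Ω τ)) (m^n≢0 (length Ω) τ {{ℕ.>-nonZero nonempty}})
        N^m>0 : 0 < N ^ m
        N^m>0 = m^n>0 N {{N>0}} m

      blocks : Vec (Vec E τ) m
      blocks = proj₁ unspoilt

      missed-blocks : ∀ q → Vec.map (missed (vertex q blocks)) blocks ≡ q
      missed-blocks q = trans (sym (tabulate∘lookup _)) (trans (tabulate-cong pointwise) (tabulate∘lookup q))
        where
        not-spoilt : ∀ j → spoilt q j blocks ≡ 0
        not-spoilt j = n≤0⇒n≡0 (≤-trans
          (≤-trans (∑-member (λ j → spoilt q j blocks) (∈-allFin j))
                   (∑-member (λ q → ∑ (allFin m) (λ j → spoilt q j blocks)) (∈-tuples ∈-bools q)))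
          (≤-reflexive (proj₂ unspoilt)))
        agree : ∀ j → missed (vertex q blocks) (lookup blocks j) ≡ lookup q j
        agree j with lookup q j in eq | not-spoilt j
        ... | true  | _ = vertex-misses q blocks j eq
        ... | false | z with missed (vertex q blocks) (lookup blocks j)
        ...   | false = refl
        pointwise : ∀ j → lookup (Vec.map (missed (vertex q blocks)) blocks) j ≡ lookup q j
        pointwise j = trans (lookup-map j _ blocks) (agree j)

      -- The pattern of missed blocks is a function of the trace on all sampled edges, so at least
      -- 2^m traces occur, and Sauer-Shelah shatters d of the edges.
      dual-shattered : ∀ d → suc (m * τ) ^ d < 2 ^ m →
                       ∃ λ (es : Vec E d) → ∀ q → ∃ λ v → trace es v ≡ q
      dual-shattered d small =
        let ι , sh = sauer-shelah d realised (<-≤-trans small (2^≤count m realised (decode m) onto)) in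
        Vec.map (lookup es) ι , λ q →
          let x , fx , eq = sh q
              q' , tr = witness x fx
          in vertex q' blocks , trans (traces ι q' x tr) eq
        where
        open ≡-Reasoning
        es = concat blocks
        -- Only traces of the chosen vertices are collected. They are indexed by bit vectors, so
        -- membership is decidable although `V` is arbitrary.
        realised? : ∀ x → Dec (∃ λ q → trace es (vertex q blocks) ≡ x)
        realised? x = anySubset? (λ q → ≡-dec Bool._≟_ (trace es (vertex q blocks)) x)
        realised : Vec Bool (m * τ) → Bool
        realised x = does (realised? x)
        witness : ∀ x → realised x ≡ true → ∃ λ q → trace es (vertex q blocks) ≡ x
        witness x eq with yes w ← realised? x = w
        onto : ∀ q → ∃ λ x → realised x ≡ true × decode m x ≡ q
        onto q = trace es v , dec-true (realised? _) (q , refl) , (begin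
          decode m (trace es v)                                   ≡⟨ cong (decode m) (map-concat _ blocks) ⟩
          decode m (concat (Vec.map (λ b → trace b v) blocks))    ≡⟨ decode-concat (Vec.map (λ b → trace b v) blocks) ⟩
          Vec.map allFalse (Vec.map (λ b → trace b v) blocks)     ≡⟨ map-∘ allFalse (λ b → trace b v) blocks ⟨
          Vec.map (missed v) blocks                               ≡⟨ missed-blocks q ⟩
          q                                                       ∎)
          where v = vertex q blocks
        traces : ∀ {d} (ι : Vec (Fin (m * τ)) d) q x → trace es (vertex q blocks) ≡ x →
                 trace (Vec.map (lookup es) ι) (vertex q blocks) ≡ Vec.map (lookup x) ι
        traces ι q x refl = trans (sym (map-∘ _ (lookup es) ι)) (map-cong (λ i → sym (lookup-map i _ es)) ι)

-- From dual shattering to shattering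

isOne : Fin 2 → Bool
isOne zero       = false
isOne (suc zero) = true

fromBool : Bool → Fin 2
fromBool false = zero
fromBool true  = suc zero

isOne-fromBool : ∀ b → isOne (fromBool b) ≡ b
isOne-fromBool false = refl
isOne-fromBool true  = refl

-- The edges are indexed by the n-bit numbers; the i-th vertex lies in the edges whose i-th bit is 1.
dual⇒primal : ∀ {E V : Set} (inc : E → V → Bool) n →
  (∃ λ (es : Vec E (2 ^ n)) → ∀ q → ∃ λ v → trace inc es v ≡ q) →
  ∃ λ (vs : Vec V n) → ∀ s → ∃ λ e → Vec.map (inc e) vs ≡ s
dual⇒primal inc n (es , sh) = tabulate u , λ s → lookup es (code s) , (begin
  Vec.map (inc (lookup es (code s))) (tabulate u)      ≡⟨ tabulate-∘ _ u ⟨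
  tabulate (λ i → inc (lookup es (code s)) (u i))      ≡⟨ tabulate-cong (λ i → trans (u-bit (code s) i) (code-bit s i)) ⟩
  tabulate (lookup s)                                  ≡⟨ tabulate∘lookup s ⟩
  s                                                    ∎)
  where
  open ≡-Reasoning
  bits : Fin (2 ^ n) → Fin n → Bool
  bits b i = isOne (finToFun b i)
  column : Fin n → Vec Bool (2 ^ n)
  column i = tabulate (λ b → bits b i)
  u = λ i → proj₁ (sh (column i))
  code : Vec Bool n → Fin (2 ^ n)
  code s = funToFin (fromBool ∘ lookup s)
  code-bit : ∀ s i → bits (code s) i ≡ lookup s i
  code-bit s i = trans (cong isOne (finToFun-funToFin (fromBool ∘ lookup s) i)) (isOne-fromBool (lookup s i))
  u-bit : ∀ b i → inc (lookup es b) (u i) ≡ bits b i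
  u-bit b i = begin
    inc (lookup es b) (u i)                ≡⟨ lookup-map b _ es ⟨
    lookup (trace inc es (u i)) b          ≡⟨ cong (λ x → lookup x b) (proj₂ (sh (column i))) ⟩
    lookup (column i) b                    ≡⟨ lookup∘tabulate _ b ⟩
    bits b i                               ∎

-- Clearing denominators

ℕ→ℚᵘ : ℕ → ℚᵘ
ℕ→ℚᵘ w = mkℚᵘ (ℤ.+ w) 0

record Scaled (Q : ℕ) (q : ℚᵘ) (w : ℕ) : Set where
  constructor scaled
  field equation : q ℚᵘ.* ℕ→ℚᵘ Q ≃ᵘ ℕ→ℚᵘ w

scaled-≃ : ∀ {Q q q' w} → q ≃ᵘ q' → Scaled Q q' w → Scaled Q q w
scaled-≃ q≃q' (scaled s) = scaled (ℚᵘ.≃-trans (ℚᵘ.*-congʳ q≃q') s)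

scaled-+ : ∀ {Q q q' w w'} → Scaled Q q w → Scaled Q q' w' → Scaled Q (q ℚᵘ.+ q') (w + w')
scaled-+ {Q} {q} {q'} {w} {w'} (scaled s) (scaled s') =
  scaled (ℚᵘ.≃-trans (ℚᵘ.*-distribʳ-+ (ℕ→ℚᵘ Q) q q') (ℚᵘ.≃-trans (ℚᵘ.+-cong s s') (*≡* eq)))
  where
  eq : (ℤ.+ w ℤ.* ℤ.+ 1 ℤ.+ ℤ.+ w' ℤ.* ℤ.+ 1) ℤ.* ℤ.+ 1 ≡ ℤ.+ (w + w') ℤ.* ℤ.+ 1
  eq = cong (ℤ._* ℤ.+ 1) (trans (cong₂ ℤ._+_ (ℤ.*-identityʳ (ℤ.+ w)) (ℤ.*-identityʳ (ℤ.+ w'))) (sym (ℤ.pos-+ w w')))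

scaled-* : ∀ {Q q w} r → Scaled Q q w → Scaled (r * Q) q (r * w)
scaled-* {Q} {q} {w} r (scaled s) = scaled (begin
  q ℚᵘ.* ℕ→ℚᵘ (r * Q)              ≈⟨ ℚᵘ.*-congˡ {q} (mult Q) ⟩
  q ℚᵘ.* (ℕ→ℚᵘ Q ℚᵘ.* ℕ→ℚᵘ r)      ≈⟨ ℚᵘ.*-assoc q (ℕ→ℚᵘ Q) (ℕ→ℚᵘ r) ⟨
  q ℚᵘ.* ℕ→ℚᵘ Q ℚᵘ.* ℕ→ℚᵘ r        ≈⟨ ℚᵘ.*-congʳ s ⟩
  ℕ→ℚᵘ w ℚᵘ.* ℕ→ℚᵘ r               ≈⟨ mult w ⟨
  ℕ→ℚᵘ (r * w)                     ∎)
  where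
  open ≃ᵘ-Reasoning
  mult : ∀ a → ℕ→ℚᵘ (r * a) ≃ᵘ ℕ→ℚᵘ a ℚᵘ.* ℕ→ℚᵘ r
  mult a = *≡* (cong (ℤ._* ℤ.+ 1) (trans (cong ℤ.+_ (*-comm r a)) (ℤ.pos-* a r)))

scaled-mono : ∀ {Q q q' w w'} → q ℚᵘ.≤ q' → Scaled Q q w → Scaled Q q' w' → w ≤ w'
scaled-mono {Q} {q} {q'} {w} {w'} q≤q' (scaled s) (scaled s')
  with ℚᵘ.≤-respʳ-≃ s' (ℚᵘ.≤-respˡ-≃ s (ℚᵘ.*-monoˡ-≤-nonNeg (ℕ→ℚᵘ Q) q≤q'))
... | *≤* le = ℤ.drop‿+≤+ (subst₂ ℤ._≤_ (ℤ.*-identityʳ (ℤ.+ w)) (ℤ.*-identityʳ (ℤ.+ w')) le)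

scaled-ℕ : ∀ Q r → Scaled Q (ℕ→ℚᵘ r) (r * Q)
scaled-ℕ Q r = scaled (*≡* (cong (ℤ._* ℤ.+ 1) (sym (ℤ.pos-* r Q))))

scaled-0 : ∀ Q → Scaled Q (toℚᵘ 0ℚ) 0
scaled-0 Q = scaled-ℕ Q 0

scaled-1 : ∀ Q → Scaled Q (toℚᵘ 1ℚ) Q
scaled-1 Q = subst (Scaled Q (ℕ→ℚᵘ 1)) (+-identityʳ Q) (scaled-ℕ Q 1)

scaled-denominator : ∀ q → 0ℚ ℚ.≤ q → ∃ λ Q → 0 < Q × ∃ λ w → Scaled Q (toℚᵘ q) w
scaled-denominator (mkℚ (ℤ.+ a) d cop) 0≤q = suc d , s≤s z≤n , a , scaled
  (*≡* (trans (ℤ.*-identityʳ (ℤ.+ a ℤ.* ℤ.+ suc d)) (cong (λ z → ℤ.+ a ℤ.* ℤ.+ suc z) (sym (*-identityʳ d)))))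
scaled-denominator (mkℚ -[1+ a ] d cop) (ℚ.*≤* ())

clear-denominators : ∀ (γ : Fin m → ℚ) → (∀ i → 0ℚ ℚ.≤ γ i) →
  ∃ λ Q → 0 < Q × ∃ λ (w : Fin m → ℕ) → ∀ i → Scaled Q (toℚᵘ (γ i)) (w i)
clear-denominators {zero}  γ nonneg = 1 , s≤s z≤n , (λ ()) , λ ()
clear-denominators {suc m} γ nonneg
  with scaled-denominator (γ zero) (nonneg zero) | clear-denominators (γ ∘ suc) (nonneg ∘ suc)
... | Q₀ , Q₀>0 , w₀ , s₀ | Q , Q>0 , w , s =
  Q₀ * Q , *-mono-≤ Q₀>0 Q>0 , w' , s'
  where
  w' : Fin (suc m) → ℕ
  w' zero    = Q * w₀
  w' (suc i) = Q₀ * w i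
  s' : ∀ i → Scaled (Q₀ * Q) (toℚᵘ (γ i)) (w' i)
  s' zero    = subst (λ z → Scaled z (toℚᵘ (γ zero)) (Q * w₀)) (*-comm Q Q₀) (scaled-* Q s₀)
  s' (suc i) = scaled-* Q₀ (s i)

-- Repeating each edge as often as its integer weight turns weighted sums into counts, so that
-- uniform sampling from the list follows the weights.
multiset : ∀ m → (Fin m → ℕ) → List (Fin m)
multiset zero    w = []
multiset (suc m) w = replicate (w zero) zero ++ List.map suc (multiset m (w ∘ suc))

scaled-sum : ∀ m {Q} (γ : Fin m → ℚ) w → (∀ i → Scaled Q (toℚᵘ (γ i)) (w i)) → (b : Fin m → Bool) →
  Scaled Q (toℚᵘ (sumℚ m (λ i → if b i then γ i else 0ℚ))) (∑ (multiset m w) (bit ∘ b))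
scaled-sum zero    {Q} γ w s b = scaled-0 Q
scaled-sum (suc m) {Q} γ w s b = subst (Scaled Q _) (sym split)
  (scaled-≃ (ℚ.toℚᵘ-homo-+ x y)
    (scaled-+ {q = toℚᵘ x} {toℚᵘ y} (term (b zero)) (scaled-sum m (γ ∘ suc) (w ∘ suc) (s ∘ suc) (b ∘ suc))))
  where
  x = if b zero then γ zero else 0ℚ
  y = sumℚ m (λ i → if b (suc i) then γ (suc i) else 0ℚ)
  rest = List.map suc (multiset m (w ∘ suc))
  ∑-replicate : ∀ r → ∑ (replicate r zero) (bit ∘ b) ≡ r * bit (b zero)
  ∑-replicate zero    = refl
  ∑-replicate (suc r) = cong (λ z → bit (b zero) + z) (∑-replicate r)
  split : ∑ (multiset (suc m) w) (bit ∘ b) ≡ w zero * bit (b zero) + ∑ (multiset m (w ∘ suc)) (bit ∘ b ∘ suc)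
  split = trans (∑-++ (replicate (w zero) zero) rest (bit ∘ b))
                (cong₂ _+_ (∑-replicate (w zero)) (∑-map suc (multiset m (w ∘ suc)) (bit ∘ b)))
  term : ∀ c → Scaled Q (toℚᵘ (if c then γ zero else 0ℚ)) (w zero * bit c)
  term true  = subst (Scaled Q _) (sym (*-identityʳ (w zero))) (s zero)
  term false = subst (Scaled Q _) (sym (*-zeroʳ (w zero))) (scaled-0 Q)

incidence : (H : Hypergraph) → Fin (nE H) → Fin (nV H) → Bool
incidence H e v = lookup (edge H e) v

-- An integer upper bound, not the least one: the denominator is at least 1, so the numerator
-- suffices. The successor gives the shape `suc μ` that the sampling argument asks for.
ceil : ℚ → ℕ
ceil c = suc ℤ.∣ ℚ.numerator c ∣

≤ceil : ∀ c → toℚᵘ c ℚᵘ.≤ ℕ→ℚᵘ (ceil c)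
≤ceil (mkℚ (ℤ.+ a) d _) = *≤* (subst₂ ℤ._≤_ (sym (ℤ.*-identityʳ (ℤ.+ a))) (ℤ.pos-* (suc a) (suc d))
  (ℤ.+≤+ (≤-trans (n≤1+n a) (m≤m*n (suc a) (suc d)))))
≤ceil (mkℚ -[1+ a ] d _) = *≤* ℤ.-≤+

-- `Q` is a common denominator of the weights. Each v in X is hit by at least Q of at most
-- `ceil c * Q` entries, a share of at least 1 in `ceil c`.
fractional-cover⇒multiset : ∀ H X c → ρ*≤ H X c → ∃ λ Q → ∃ λ Ω →
  0 < Q × length Ω ≤ ceil c * Q × (∀ v → v ∈ X → Q ≤ hits (incidence H) Ω v)
fractional-cover⇒multiset H X c (γ , (nonneg , covers) , total)
  with clear-denominators γ nonneg
... | Q , Q>0 , w , s = Q , Ω , Q>0 ,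
  subst (_≤ ceil c * Q) (sym (length-∑ Ω))
    (scaled-mono (ℚᵘ.≤-trans (ℚ.toℚᵘ-mono-≤ total) (≤ceil c)) (scaled-sum _ γ w s (λ _ → true)) (scaled-ℕ Q (ceil c))) ,
  λ v v∈X → scaled-mono (ℚ.toℚᵘ-mono-≤ (covers v v∈X)) (scaled-1 Q) (scaled-sum _ γ w s (λ e → incidence H e v))
  where Ω = multiset _ w

-- Covers of bounded size

-- Exhaustive search. The arguments below go by contradiction, and decidable finite searches make
-- that constructive.
anyList? : ∀ {N} k {P : List (Fin N) → Set} → Decidable P → Dec (∃ λ S → length S ≤ k × P S)
anyList? zero P? = map′ (λ p → [] , z≤n , p) (λ { ([] , _ , p) → p }) (P? [])
anyList? (suc k) P? = map′
  (λ { (inj₁ p) → [] , z≤n , p ; (inj₂ (e , S , le , p)) → e ∷ S , s≤s le , p })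
  (λ { ([] , _ , p) → inj₁ p ; (e ∷ S , s≤s le , p) → inj₂ (e , S , le , p) })
  (P? [] ⊎-dec any? (λ e → anyList? k (λ S → P? (e ∷ S))))

anyVec? : ∀ {N} k {P : Vec (Fin N) k → Set} → Decidable P → Dec (∃ P)
anyVec? zero    P? = map′ (λ p → [] , p) (λ { ([] , p) → p }) (P? [])
anyVec? (suc k) P? = map′ (λ { (v , vs , p) → v ∷ vs , p }) (λ { (v ∷ vs , p) → v , vs , p })
  (any? (λ v → anyVec? k (λ vs → P? (v ∷ vs))))

Shattered : Hypergraph → ℕ → Set
Shattered H n = ∃ λ (vs : Vec (Fin (nV H)) n) → ∀ s → ∃ λ e → Vec.map (incidence H e) vs ≡ s

shattered? : ∀ H n → Dec (Shattered H n)
shattered? H n = anyVec? n λ vs →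
  let tr? = λ s → any? (λ e → ≡-dec Bool._≟_ (Vec.map (incidence H e) vs) s) in
  map′ (λ none s → decidable-stable (tr? s) (λ ¬tr → none (s , ¬tr)))
       (λ all (s , ¬tr) → ¬tr (all s))
       (¬? (anySubset? (λ s → ¬? (tr? s))))

Missing : (H : Hypergraph) → Subset (nV H) → List (Fin (nE H)) → Set
Missing H X S = ∃ λ v → v ∈ X × ∀ {e} → e ∈ˡ S → incidence H e v ≡ false

missing? : ∀ H X S → Dec (Missing H X S)
missing? H X S = any? λ v → (v ∈? X) ×-dec
  map′ (λ all {e} → All.lookup all) (λ f → All.tabulate f)
       (All.all? (λ e → incidence H e v Bool.≟ false) S)

Covers : (H : Hypergraph) → List (Fin (nE H)) → Subset (nV H) → Set
Covers H S X = ∀ v → v ∈ X → ∃ λ e → e ∈ˡ S × v ∈ edge H e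

¬missing⇒covers : ∀ H X S → ¬ Missing H X S → Covers H S X
¬missing⇒covers H X S ¬missing v v∈X with Any.any? (λ e → v ∈? edge H e) S
... | yes w = let e , e∈S , v∈e = find w in e , e∈S , v∈e
... | no ¬w = contradiction (v , v∈X , λ {_} e∈S → Bool.¬-not (λ eq → ¬w (lose e∈S (lookup⇒[]= v _ eq)))) ¬missing

module _ (n : ℕ) (c : ℚ) where

  -- Abstract because the witness is too large to be normalised.
  private abstract
    growth : ∃ λ m → suc (ceil c * 2 * (m * m)) ^ (2 ^ n) < 2 ^ m
    growth = polynomial<exponential (ceil c * 2) (2 ^ n)

  private
    blockNumber : ℕ
    blockNumber = proj₁ growth

  -- The number of sampled edges: m blocks of length `ceil c` times 2m. It depends on n and c only,
  -- and `growth` puts the Sauer-Shelah bound for shattering 2^n of so many edges below 2^m.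
  coverBound : ℕ
  coverBound = blockNumber * (ceil c * (2 * blockNumber))

  uncoverable⇒shattered : ∀ H X → ρ*≤ H X c →
    (∀ S → length S ≤ coverBound → Missing H X S) → Shattered H n
  uncoverable⇒shattered H X frac uncovered with fractional-cover⇒multiset H X c frac
  ... | Q , Ω , Q>0 , len , heavy = dual⇒primal (incidence H) n
    (dual-shattered (incidence H) Ω ℤ.∣ ℚ.numerator c ∣ (_∈ X)
      (λ v v∈X → ≤-trans len (*-monoʳ-≤ (ceil c) (heavy v v∈X)))
      nonempty blockNumber uncovered (2 ^ n)
      (subst (λ z → suc z ^ 2 ^ n < 2 ^ blockNumber) (regroup (ceil c) blockNumber) (proj₂ growth)))
    where
    regroup : ∀ a m → a * 2 * (m * m) ≡ m * (a * (2 * m))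
    regroup a m = trans (cong (_* (m * m)) (*-comm a 2))
      (solve 2 (λ a b → con 2 :* a :* (b :* b) := b :* (a :* (con 2 :* b))) refl a m)
    nonempty : 0 < length Ω
    nonempty = let v , v∈X , _ = uncovered [] z≤n in
      ≤-trans (≤-trans Q>0 (heavy v v∈X))
              (≤-trans (m≤m+n _ _) (≤-reflexive (hits+misses (incidence H) Ω v)))

  small-cover : ∀ H X → ¬ Shattered H n → ρ*≤ H X c →
                ∃ λ S → length S ≤ coverBound × Covers H S X
  small-cover H X ¬shattered frac =
    let S , le , ¬missing = decidable-stable dec λ ¬cover →
          ¬shattered (uncoverable⇒shattered H X frac λ S le →
            decidable-stable (missing? H X S) λ ¬miss → ¬cover (S , le , ¬miss))
    in S , le , ¬missing⇒covers H X S ¬missing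
    where
    dec : Dec (∃ λ S → length S ≤ coverBound × ¬ Missing H X S)
    dec = anyList? coverBound (λ S → ¬? (missing? H X S))

-- Shattered sets make a class exotic

setOf : List (Fin m) → Subset m
setOf []       = ⊥
setOf (v ∷ vs) = ⁅ v ⁆ ∪ setOf vs

∈-setOf⁺ : ∀ {vs : List (Fin m)} {v} → v ∈ˡ vs → v ∈ setOf vs
∈-setOf⁺ (here refl) = x∈p∪q⁺ (inj₁ (x∈⁅x⁆ _))
∈-setOf⁺ (there v∈)  = x∈p∪q⁺ (inj₂ (∈-setOf⁺ v∈))

∈-setOf⁻ : ∀ (vs : List (Fin m)) {v} → v ∈ setOf vs → v ∈ˡ vs
∈-setOf⁻ []       v∈ = contradiction v∈ ∉⊥
∈-setOf⁻ (w ∷ vs) v∈ with x∈p∪q⁻ ⁅ w ⁆ (setOf vs) v∈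
... | inj₁ v∈w = here (x∈⁅y⁆⇒x≡y w v∈w)
... | inj₂ v∈′ = there (∈-setOf⁻ vs v∈′)

∣⁅x⁆∪p∣≤ : ∀ (x : Fin n) p → ∣ ⁅ x ⁆ ∪ p ∣ ≤ suc ∣ p ∣
∣⁅x⁆∪p∣≤ zero    (true  ∷ p) = s≤s (≤-trans (≤-reflexive (cong ∣_∣ (∪-identityˡ p))) (n≤1+n _))
∣⁅x⁆∪p∣≤ zero    (false ∷ p) = s≤s (≤-reflexive (cong ∣_∣ (∪-identityˡ p)))
∣⁅x⁆∪p∣≤ (suc x) (true  ∷ p) = s≤s (∣⁅x⁆∪p∣≤ x p)
∣⁅x⁆∪p∣≤ (suc x) (false ∷ p) = ∣⁅x⁆∪p∣≤ x p

∣setOf∣≤ : ∀ (vs : List (Fin m)) → ∣ setOf vs ∣ ≤ length vs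
∣setOf∣≤ {m} []       = ≤-reflexive (∣⊥∣≡0 m)
∣setOf∣≤     (v ∷ vs) = ≤-trans (∣⁅x⁆∪p∣≤ v (setOf vs)) (s≤s (∣setOf∣≤ vs))

∣⁅x⁆∪p∣ : ∀ (x : Fin n) p → x ∉ p → ∣ ⁅ x ⁆ ∪ p ∣ ≡ suc ∣ p ∣
∣⁅x⁆∪p∣ zero    (true  ∷ p) x∉p = contradiction Vec.here x∉p
∣⁅x⁆∪p∣ zero    (false ∷ p) x∉p = cong (λ q → suc ∣ q ∣) (∪-identityˡ p)
∣⁅x⁆∪p∣ (suc x) (true  ∷ p) x∉p = cong suc (∣⁅x⁆∪p∣ x p (x∉p ∘ Vec.there))
∣⁅x⁆∪p∣ (suc x) (false ∷ p) x∉p = ∣⁅x⁆∪p∣ x p (x∉p ∘ Vec.there)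

∣setOf∣ : ∀ {vs : List (Fin m)} → Unique vs → ∣ setOf vs ∣ ≡ length vs
∣setOf∣ {m} []                   = ∣⊥∣≡0 m
∣setOf∣ {vs = v ∷ vs} (v∉ ∷ uniq) = trans
  (∣⁅x⁆∪p∣ v (setOf vs) (λ v∈ → All.lookup v∉ (∈-setOf⁻ vs v∈) refl)) (cong suc (∣setOf∣ uniq))

unique-tuples : ∀ n → Unique (tuples bools n)
unique-tuples zero    = [] ∷ []
unique-tuples (suc n) = Unique.cartesianProductWith⁺ _∷_ ∷-injective (((λ ()) ∷ []) ∷ [] ∷ []) (unique-tuples n)

-- `bools` starts with `false`, so the empty pattern heads the list; dropping it leaves 2^n ∸ 1
-- patterns, nonempty by uniqueness.
tuples-⊥ : ∀ n → ∃ λ ss → tuples bools n ≡ ⊥ ∷ ss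
tuples-⊥ zero    = [] , refl
tuples-⊥ (suc n) with tuples bools n | tuples-⊥ n
... | .(⊥ ∷ ss) | ss , refl = _ , refl

nonempty-patterns : ∀ n → ∃ λ (ss : List (Subset n)) → Unique ss × All (_≢ ⊥) ss × length ss ≡ 2 ^ n ∸ 1
nonempty-patterns n with tuples bools n | tuples-⊥ n | unique-tuples n | length-tuples bools n
... | .(⊥ ∷ ss) | ss , refl | ⊥∉ ∷ uniq | len = ss , uniq , All.map (λ ≢ eq → ≢ (sym eq)) ⊥∉ , cong (_∸ 1) len

-- Each nonempty pattern is sent to the trace on U of an edge realising it. The trace determines the
-- pattern, so traces are distinct and nonempty. Singleton patterns tell the n vertices apart, so U
-- has exactly n elements.
shattered⇒induced : ∀ H n → Shattered H n →
  ∃ λ U → ∣ U ∣ ≡ n × HasAtLeastInducedEdges H U (2 ^ n ∸ 1)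
shattered⇒induced H n (vs , sh) with nonempty-patterns n
... | ss , uniq , nonempty , len =
  U , trans (∣setOf∣ (Unique.tabulate⁺ (distinct _ _))) (length-tabulate (lookup vs)) ,
  List.map f ss , Unique.map⁺ f-injective uniq , All.map⁺ (All.map induced nonempty) ,
  ≤-reflexive (trans (sym len) (sym (length-map f ss)))
  where
  U = setOf (List.tabulate (lookup vs))
  e : Subset n → Fin (nE H)
  e s = proj₁ (sh s)
  e-bit : ∀ s i → lookup (edge H (e s)) (lookup vs i) ≡ lookup s i
  e-bit s i = trans (sym (lookup-map i _ vs)) (cong (λ x → lookup x i) (proj₂ (sh s)))
  f : Subset n → Subset (nV H)
  f s = edge H (e s) ∩ U
  ∈f⁺ : ∀ s i → lookup s i ≡ true → lookup vs i ∈ f s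
  ∈f⁺ s i eq = x∈p∩q⁺ (lookup⇒[]= _ _ (trans (e-bit s i) eq) , ∈-setOf⁺ (∈-tabulate⁺ i))
  ∈f⁻ : ∀ s i → lookup vs i ∈ f s → lookup s i ≡ true
  ∈f⁻ s i v∈ = trans (sym (e-bit s i)) ([]=⇒lookup (proj₁ (x∈p∩q⁻ (edge H (e s)) U v∈)))
  ext : ∀ {s s' : Subset n} → (∀ i → lookup s i ≡ lookup s' i) → s ≡ s'
  ext {s} {s'} eq = trans (sym (tabulate∘lookup s)) (trans (tabulate-cong eq) (tabulate∘lookup s'))
  f-injective : ∀ {s s'} → f s ≡ f s' → s ≡ s'
  f-injective {s} {s'} eq = ext agree
    where
    agree : ∀ i → lookup s i ≡ lookup s' i
    agree i with lookup s i in eq₁ | lookup s' i in eq₂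
    ... | true  | true  = refl
    ... | false | false = refl
    ... | true  | false = trans (sym (∈f⁻ s' i (subst (lookup vs i ∈_) eq (∈f⁺ s i eq₁)))) eq₂
    ... | false | true  = trans (sym eq₁) (∈f⁻ s i (subst (lookup vs i ∈_) (sym eq) (∈f⁺ s' i eq₂)))
  induced : ∀ {s} → s ≢ ⊥ → IsInducedEdge H U (f s)
  induced {s} s≢⊥ = (λ fs≡⊥ → s≢⊥ (ext λ i → trans (Bool.¬-not (λ eq →
      ∉⊥ (subst (lookup vs i ∈_) fs≡⊥ (∈f⁺ s i eq)))) (sym (lookup-replicate i false)))) ,
    e s , refl
  distinct : ∀ i j → lookup vs i ≡ lookup vs j → i ≡ j
  distinct i j eq = sym (x∈⁅y⁆⇒x≡y i (lookup⇒[]= j ⁅ i ⁆ (begin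
    lookup ⁅ i ⁆ j                                 ≡⟨ e-bit ⁅ i ⁆ j ⟨
    lookup (edge H (e ⁅ i ⁆)) (lookup vs j)        ≡⟨ cong (lookup (edge H (e ⁅ i ⁆))) eq ⟨
    lookup (edge H (e ⁅ i ⁆)) (lookup vs i)        ≡⟨ e-bit ⁅ i ⁆ i ⟩
    lookup ⁅ i ⁆ i                                 ≡⟨ []=⇒lookup (x∈⁅x⁆ i) ⟩
    true                                           ∎)))
    where open ≡-Reasoning

comprehension : {P : Fin n → Set} → Decidable P → Subset n
comprehension P? = tabulate (λ x → does (P? x))

∈-comprehension⁺ : {P : Fin n → Set} (P? : Decidable P) → ∀ {x} → P x → x ∈ comprehension P?
∈-comprehension⁺ P? {x} p = lookup⇒[]= x _ (trans (lookup∘tabulate _ x) (dec-true (P? x) p))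

∈-comprehension⁻ : {P : Fin n → Set} (P? : Decidable P) → ∀ {x} → x ∈ comprehension P? → P x
∈-comprehension⁻ P? {x} x∈ with P? x | trans (sym (lookup∘tabulate (λ x → does (P? x)) x)) ([]=⇒lookup x∈)
... | yes p | _ = p

-- Attaching a tree below the root of another

desc-root : ∀ T {u} → Desc T u zero → u ≡ zero
desc-root T self               = refl
desc-root T (down _ (i , () , _))

walk-start : ∀ {T S x y} → WalkIn T S x y → S x
walk-start (here Sx)     = Sx
walk-start (step Sx _ _) = Sx

walk-map : ∀ {T T' S S'} (g : Node T → Node T') → (∀ {u} → S u → S' (g u)) →
           (∀ {u w} → Adj T u w → Adj T' (g u) (g w)) →
           ∀ {x y} → WalkIn T S x y → WalkIn T' S' (g x) (g y)
walk-map g s a (here Sx)       = here (s Sx)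
walk-map g s a (step Sx adj w) = step (s Sx) (a adj) (walk-map g s a w)

walk-join : ∀ {T S x y z w} → WalkIn T S x y → Adj T y z → WalkIn T S z w → WalkIn T S x w
walk-join (here Sx)        adj w = step Sx adj w
walk-join (step Sx adj′ v) adj w = step Sx adj′ (walk-join v adj w)

module Graft (T T' : Tree) where

  private
    a b : ℕ
    a = size T
    b = size T'

  -- Index i stands for node `suc i`, so the nodes of `T'` start at index a. Its root becomes a
  -- child of the root of `T`; the other parents shift along with their children.
  grafted-par : Fin a ⊎ Fin (suc b) → Fin (suc a + suc b)
  grafted-par (inj₁ i)       = par T i ↑ˡ suc b
  grafted-par (inj₂ zero)    = zero
  grafted-par (inj₂ (suc j)) = suc a ↑ʳ par T' j

  grafted : Tree
  grafted .size       = a + suc b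
  grafted .par i      = grafted-par (splitAt a i)
  grafted .par-lt i with splitAt a i in eq
  ... | inj₁ j       = subst₂ _≤_ (sym (toℕ-↑ˡ (par T j) (suc b)))
                         (trans (sym (toℕ-↑ˡ j (suc b))) (cong toℕ (splitAt⁻¹-↑ˡ eq))) (par-lt T j)
  ... | inj₂ zero    = z≤n
  ... | inj₂ (suc j) = begin
    toℕ (suc a ↑ʳ par T' j)       ≡⟨ toℕ-↑ʳ (suc a) (par T' j) ⟩
    suc a + toℕ (par T' j)        ≤⟨ +-monoʳ-≤ (suc a) (par-lt T' j) ⟩
    suc a + toℕ j                 ≡⟨ +-suc a (toℕ j) ⟨
    a + suc (toℕ j)               ≡⟨ toℕ-↑ʳ a (suc j) ⟨
    toℕ (a ↑ʳ suc j)              ≡⟨ cong toℕ (splitAt⁻¹-↑ʳ eq) ⟩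
    toℕ i                         ∎
    where open ≤-Reasoning

  inl : Node T → Node grafted
  inl u = u ↑ˡ suc b

  inr : Node T' → Node grafted
  inr u = suc a ↑ʳ u

  data View : Node grafted → Set where
    left  : ∀ u → View (inl u)
    right : ∀ u → View (inr u)

  view : ∀ u → View u
  view u with splitAt (suc a) u in eq
  ... | inj₁ x = subst View (splitAt⁻¹-↑ˡ eq) (left x)
  ... | inj₂ y = subst View (splitAt⁻¹-↑ʳ eq) (right y)

  data Edge : Node grafted → Node grafted → Set where
    left  : ∀ {p c} → ParentOf T p c → Edge (inl p) (inl c)
    link  : Edge zero (inr zero)
    right : ∀ {p c} → ParentOf T' p c → Edge (inr p) (inr c)

  edge⁻ : ∀ {p c} → ParentOf grafted p c → Edge p c
  edge⁻ (i , refl , refl) with splitAt a i in eq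
  ... | inj₁ j       rewrite sym (splitAt⁻¹-↑ˡ {i = i} eq) = left (j , refl , refl)
  ... | inj₂ zero    rewrite sym (splitAt⁻¹-↑ʳ {i = i} eq) = link
  ... | inj₂ (suc j) rewrite sym (splitAt⁻¹-↑ʳ {i = i} eq) = right (j , refl , refl)

  edge⁺ : ∀ {p c} → Edge p c → ParentOf grafted p c
  edge⁺ (left (i , refl , refl))  = i ↑ˡ suc b , refl , sym (cong grafted-par (splitAt-↑ˡ a i (suc b)))
  edge⁺ link                      = a ↑ʳ zero , refl , sym (cong grafted-par (splitAt-↑ʳ a (suc b) zero))
  edge⁺ (right (i , refl , refl)) = a ↑ʳ suc i , refl , sym (cong grafted-par (splitAt-↑ʳ a (suc b) (suc i)))

  inl≢inr : ∀ {x y} → inl x ≢ inr y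
  inl≢inr {x} {y} eq with trans (sym (splitAt-↑ˡ (suc a) x (suc b))) (trans (cong (splitAt (suc a)) eq) (splitAt-↑ʳ (suc a) (suc b) y))
  ... | ()

  -- The new nodes are descendants of the root of `T` and of no other node of `T`, so grafting adds
  -- a case to the special condition at that root only.
  data Below (u : Node T) : Node grafted → Set where
    left  : ∀ {w} → Desc T u w → Below u (inl w)
    right : ∀ {w} → u ≡ zero → Below u (inr w)

  desc-inl : ∀ {u w} → Desc grafted (inl u) w → Below u w
  desc-inl self       = left self
  desc-inl {u} (down d e) = extend (desc-inl d) refl (edge⁻ e)
    where
    extend : ∀ {x x' y} → Below u x → x ≡ x' → Edge x' y → Below u y
    extend (left d)  eq (left e)  = left (down d (subst (λ z → ParentOf T z _) (sym (↑ˡ-injective (suc b) _ _ eq)) e))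
    extend (left {w} d)  eq link  = right (desc-root T (subst (Desc T u) (↑ˡ-injective (suc b) w zero eq) d))
    extend (left d)  eq (right e) = contradiction eq inl≢inr
    extend (right r) eq (left e)  = contradiction (sym eq) inl≢inr
    extend (right r) eq link      = right r
    extend (right r) eq (right e) = right r

  desc-inr : ∀ {u w} → Desc grafted (inr u) w → ∃ λ z → w ≡ inr z × Desc T' u z
  desc-inr {u} self       = u , refl , self
  desc-inr (down d e) with desc-inr d
  ... | z , eq , d′ = extend d′ eq (edge⁻ e)
    where
    extend : ∀ {u z x' y} → Desc T' u z → x' ≡ inr z → Edge x' y → ∃ λ z' → y ≡ inr z' × Desc T' u z'
    extend d eq (left e)  = contradiction eq inl≢inr
    extend d eq link      = contradiction eq (inl≢inr {zero})
    extend d eq (right e) = _ , refl , down d (subst (λ z → ParentOf T' z _) (↑ʳ-injective (suc a) _ _ eq) e)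

-- Partial hypertree decompositions and their gluing

module _ (H : Hypergraph) where

  Covered : List (Fin (nE H)) → Fin (nV H) → Set
  Covered L v = ∃ λ e → e ∈ˡ L × v ∈ edge H e

  -- Which edges lie in a bag is tracked separately, by `Decomposes`. Covers are lists, whose
  -- lengths bound the sizes of the sets they turn into at the end.
  record Fragment (w : ℕ) : Set where
    field
      tree      : Tree
      bag       : Node tree → Subset (nV H)
      cover     : Node tree → List (Fin (nE H))
      connected : ∀ v → Connected tree (λ u → v ∈ bag u)
      bag-cov   : ∀ u v → v ∈ bag u → Covered (cover u) v
      special   : ∀ u v → Covered (cover u) v → ∀ {x} → Desc tree u x → v ∈ bag x → v ∈ bag u
      width     : ∀ u → length (cover u) ≤ w

  module _ {w : ℕ} where
    open Fragment

    rootBag : Fragment w → Subset (nV H)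
    rootBag F = bag F zero

    rootCover : Fragment w → List (Fin (nE H))
    rootCover F = cover F zero

    Occurs : Fragment w → Fin (nV H) → Set
    Occurs F v = ∃ λ u → v ∈ bag F u

    singleton : ∀ B L → (∀ v → v ∈ B → Covered L v) → length L ≤ w → Fragment w
    singleton B L cov le .tree = record { size = 0 ; par = λ () ; par-lt = λ () }
    singleton B L cov le .bag _ = B
    singleton B L cov le .cover _ = L
    singleton B L cov le .connected v zero zero v∈ _ = here v∈
    singleton B L cov le .bag-cov _ = cov
    singleton B L cov le .special _ _ _ _ v∈ = v∈
    singleton B L cov le .width _ = le

    module _ (F G : Fragment w)
             (meet  : ∀ v → Occurs F v → Occurs G v → v ∈ rootBag F × v ∈ rootBag G)
             (above : ∀ v → Covered (rootCover F) v → Occurs G v → v ∈ rootBag F) where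

      open Graft (tree F) (tree G)

      private
        both : ∀ {A : Set} → (Node (tree F) → A) → (Node (tree G) → A) → Node grafted → A
        both f g u = [ f , g ]′ (splitAt (suc (size (tree F))) u)

        both-inl : ∀ {A} (f : Node (tree F) → A) (g : Node (tree G) → A) x → both f g (inl x) ≡ f x
        both-inl f g x = cong [ f , g ]′ (splitAt-↑ˡ _ x _)

        both-inr : ∀ {A} (f : Node (tree F) → A) (g : Node (tree G) → A) y → both f g (inr y) ≡ g y
        both-inr f g y = cong [ f , g ]′ (splitAt-↑ʳ (suc (size (tree F))) _ y)

        bags : Node grafted → Subset (nV H)
        bags = both (bag F) (bag G)

        covers : Node grafted → List (Fin (nE H))
        covers = both (cover F) (cover G)

        bagˡ : ∀ x → bags (inl x) ≡ bag F x
        bagˡ = both-inl (bag F) (bag G)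

        bagʳ : ∀ y → bags (inr y) ≡ bag G y
        bagʳ = both-inr (bag F) (bag G)

        ∈ˡ⁻ : ∀ {v x} → v ∈ bags (inl x) → v ∈ bag F x
        ∈ˡ⁻ {v} {x} = subst (v ∈_) (bagˡ x)

        ∈ʳ⁻ : ∀ {v y} → v ∈ bags (inr y) → v ∈ bag G y
        ∈ʳ⁻ {v} {y} = subst (v ∈_) (bagʳ y)

        walkˡ : ∀ v {x y} → v ∈ bag F x → v ∈ bag F y → WalkIn grafted (λ u → v ∈ bags u) (inl x) (inl y)
        walkˡ v x∈ y∈ = walk-map inl (λ {u} → subst (v ∈_) (sym (bagˡ u)))
          (λ { (inj₁ e) → inj₁ (edge⁺ (left e)) ; (inj₂ e) → inj₂ (edge⁺ (left e)) }) (connected F v _ _ x∈ y∈)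

        walkʳ : ∀ v {x y} → v ∈ bag G x → v ∈ bag G y → WalkIn grafted (λ u → v ∈ bags u) (inr x) (inr y)
        walkʳ v x∈ y∈ = walk-map inr (λ {u} → subst (v ∈_) (sym (bagʳ u)))
          (λ { (inj₁ e) → inj₁ (edge⁺ (right e)) ; (inj₂ e) → inj₂ (edge⁺ (right e)) }) (connected G v _ _ x∈ y∈)

      -- `meet` lets a walk between the two trees cross the new link within the bags of v. `above`
      -- is the special condition for the root of F, the only old node that gains descendants.
      graft : Fragment w
      graft .tree  = grafted
      graft .bag   = bags
      graft .cover = covers
      graft .connected v x y x∈ y∈ with view x | view y
      ... | left p  | left q  = walkˡ v (∈ˡ⁻ x∈) (∈ˡ⁻ y∈)
      ... | right p | right q = walkʳ v (∈ʳ⁻ x∈) (∈ʳ⁻ y∈)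
      ... | left p  | right q =
        let r∈ , r'∈ = meet v (p , ∈ˡ⁻ x∈) (q , ∈ʳ⁻ y∈) in
        walk-join (walkˡ v (∈ˡ⁻ x∈) r∈) (inj₁ (edge⁺ link)) (walkʳ v r'∈ (∈ʳ⁻ y∈))
      ... | right p | left q =
        let r∈ , r'∈ = meet v (q , ∈ˡ⁻ y∈) (p , ∈ʳ⁻ x∈) in
        walk-join (walkʳ v (∈ʳ⁻ x∈) r'∈) (inj₂ (edge⁺ link)) (walkˡ v r∈ (∈ˡ⁻ y∈))
      graft .bag-cov u v v∈ with view u
      ... | left x  = subst (λ L → Covered L v) (sym (both-inl (cover F) (cover G) x)) (bag-cov F x v (∈ˡ⁻ v∈))
      ... | right y = subst (λ L → Covered L v) (sym (both-inr (cover F) (cover G) y)) (bag-cov G y v (∈ʳ⁻ v∈))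
      graft .special u v cov d v∈ with view u
      ... | left x with desc-inl d
      ...   | left d′ = subst (v ∈_) (sym (bagˡ x))
                (special F x v (subst (λ L → Covered L v) (both-inl (cover F) (cover G) x) cov) d′ (∈ˡ⁻ v∈))
      ...   | right {y} refl = above v cov (y , ∈ʳ⁻ v∈)
      graft .special u v cov d v∈ | right y with desc-inr d
      ... | z , refl , d′ = subst (v ∈_) (sym (bagʳ y))
                (special G y v (subst (λ L → Covered L v) (both-inr (cover F) (cover G) y) cov) d′ (∈ʳ⁻ v∈))
      graft .width u with view u
      ... | left x  = subst (λ L → length L ≤ w) (sym (both-inl (cover F) (cover G) x)) (width F x)
      ... | right y = subst (λ L → length L ≤ w) (sym (both-inr (cover F) (cover G) y)) (width G y)

      graft-occurs : ∀ {v} → Occurs graft v → Occurs F v ⊎ Occurs G v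
      graft-occurs (u , v∈) with view u
      ... | left x  = inj₁ (x , ∈ˡ⁻ v∈)
      ... | right y = inj₂ (y , ∈ʳ⁻ v∈)

      graft-bagˡ : ∀ x → ∃ λ u → bag graft u ≡ bag F x
      graft-bagˡ x = inl x , bagˡ x

      graft-bagʳ : ∀ y → ∃ λ u → bag graft u ≡ bag G y
      graft-bagʳ y = inr y , bagʳ y

    module _ {I : Set} (B : Subset (nV H)) (L : List (Fin (nE H)))
             (B-covered : ∀ v → v ∈ B → Covered L v) (L≤w : length L ≤ w)
             (G : I → Fragment w) (key : Fin (nV H) → I)
             (rooted : ∀ c v → Occurs (G c) v → v ∈ B → v ∈ rootBag (G c))
             (keyed  : ∀ c v → Occurs (G c) v → v ∉ B → key v ≡ c)
             (above  : ∀ c v → Covered L v → Occurs (G c) v → v ∈ B) where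

      record Assembled (cs : List I) : Set where
        field
          whole       : Fragment w
          root-bag    : rootBag whole ≡ B
          root-cover  : rootCover whole ≡ L
          occurs      : ∀ {v} → Occurs whole v → v ∈ B ⊎ ∃ λ c → c ∈ˡ cs × Occurs (G c) v
          contains    : ∀ {c} → c ∈ˡ cs → ∀ x → ∃ λ u → bag whole u ≡ bag (G c) x
      open Assembled

      -- Parts are hung one by one below a root with bag B and cover L. A vertex outside B shared by
      -- two parts would have both as its key, so parts meet only inside B, where `rooted` gives
      -- connectedness.
      assemble : ∀ {cs} → Unique cs → Assembled cs
      assemble [] .whole           = singleton B L B-covered L≤w
      assemble [] .root-bag        = refl
      assemble [] .root-cover      = refl
      assemble [] .occurs (_ , v∈) = inj₁ v∈
      assemble [] .contains ()
      assemble {c ∷ cs} (c∉ ∷ uniq) = record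
        { whole      = graft F (G c) meet above′
        ; root-bag   = root-bag rest
        ; root-cover = root-cover rest
        ; occurs     = occ
        ; contains   = cont
        }
        where
        rest = assemble uniq
        F = whole rest
        meet : ∀ v → Occurs F v → Occurs (G c) v → v ∈ rootBag F × v ∈ rootBag (G c)
        meet v oF oG with v ∈? B
        ... | yes v∈B = subst (v ∈_) (sym (root-bag rest)) v∈B , rooted c v oG v∈B
        ... | no  v∉B with occurs rest oF
        ...   | inj₁ v∈B = contradiction v∈B v∉B
        ...   | inj₂ (c' , c'∈ , oG') =
          contradiction (trans (sym (keyed c v oG v∉B)) (keyed c' v oG' v∉B)) (All.lookup c∉ c'∈)
        above′ : ∀ v → Covered (rootCover F) v → Occurs (G c) v → v ∈ rootBag F
        above′ v cov oG = subst (v ∈_) (sym (root-bag rest)) (above c v (subst (λ L → Covered L v) (root-cover rest) cov) oG)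
        occ : ∀ {v} → Occurs (graft F (G c) meet above′) v → v ∈ B ⊎ ∃ λ c' → c' ∈ˡ c ∷ cs × Occurs (G c') v
        occ o with graft-occurs F (G c) meet above′ o
        ... | inj₂ oG = inj₂ (c , here refl , oG)
        ... | inj₁ oF with occurs rest oF
        ...   | inj₁ v∈B = inj₁ v∈B
        ...   | inj₂ (c' , c'∈ , oG) = inj₂ (c' , there c'∈ , oG)
        cont : ∀ {c'} → c' ∈ˡ c ∷ cs → ∀ x → ∃ λ u → bag (graft F (G c) meet above′) u ≡ bag (G c') x
        cont (here refl) x = graft-bagʳ F (G c) meet above′ x
        cont (there c'∈) x with contains rest c'∈ x
        ... | u , eq with graft-bagˡ F (G c) meet above′ u
        ...   | u' , eq' = u' , trans eq' eq

-- Balanced separation of a tree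

module _ (T : Tree) (u : Node T) where

  -- The label names the component of T − u containing x: the component above u is
  -- labelled by the root, a component below u by the child of u it contains.
  data Label : Node T → Node T → Set where
    at    : ∀ {x} → x ≡ u → Label x x
    root  : zero ≢ u → Label zero zero
    child : ∀ {i} → par T i ≡ u → Label (suc i) (suc i)
    climb : ∀ {i c} → suc i ≢ u → par T i ≢ u → Label (par T i) c → Label (suc i) c

  label-unique : ∀ {x c c'} → Label x c → Label x c' → c ≡ c'
  label-unique (at _)         (at _)         = refl
  label-unique (at _)         (root _)       = refl
  label-unique (at _)         (child _)      = refl
  label-unique (at eq)        (climb ≢ _ _)  = contradiction eq ≢
  label-unique (root _)       (at _)         = refl
  label-unique (root _)       (root _)       = refl
  label-unique (child _)      (at _)         = refl
  label-unique (child _)      (child _)      = refl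
  label-unique (child eq)     (climb _ ≢ _)  = contradiction eq ≢
  label-unique (climb ≢ _ _)  (at eq)        = contradiction eq ≢
  label-unique (climb _ ≢ _)  (child eq)     = contradiction eq ≢
  label-unique (climb _ _ l)  (climb _ _ l') = label-unique l l'

  label-total : ∀ x → ∃ (Label x)
  label-total x = go (suc (toℕ x)) x ≤-refl
    where
    go : ∀ n x → toℕ x < n → ∃ (Label x)
    go (suc n) zero _ with zero ≟ u
    ... | yes eq = zero , at eq
    ... | no ≢   = zero , root ≢
    go (suc n) (suc i) lt with suc i ≟ u | par T i ≟ u
    ... | yes eq | _      = suc i , at eq
    ... | no _   | yes eq = suc i , child eq
    ... | no ≢   | no ≢′  = let c , l = go n (par T i) (≤-<-trans (par-lt T i) (s≤s⁻¹ lt)) in c , climb ≢ ≢′ l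

  label : Node T → Node T
  label x = proj₁ (label-total x)

  label⁺ : ∀ x → Label x (label x)
  label⁺ x = proj₂ (label-total x)

  label-≢ : ∀ {x c} → Label x c → x ≢ u → c ≢ u
  label-≢ (at eq)       x≢ = λ _ → x≢ eq
  label-≢ (root _)      x≢ = x≢
  label-≢ (child _)     x≢ = x≢
  label-≢ (climb _ ≢ l) x≢ = label-≢ l ≢

  -- A component not above u is named by a child of u, whose index is larger. This makes the search
  -- for a balanced node advance.
  label-range : ∀ {x c} → Label x c → c ≢ u → c ≡ zero ⊎ toℕ u < toℕ c
  label-range (at eq)       c≢ = contradiction eq c≢
  label-range (root _)      c≢ = inj₁ refl
  label-range (child {i} refl) c≢ = inj₂ (s≤s (par-lt T i))
  label-range (climb _ _ l) c≢ = label-range l c≢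

  label-parent : ∀ {p x} → ParentOf T p x → p ≢ u → x ≢ u → label x ≡ label p
  label-parent (i , refl , refl) p≢ x≢ = label-unique (label⁺ _) (climb x≢ p≢ (label⁺ _))

  label-walk : ∀ {S : Node T → Set} → (∀ {x} → S x → x ≢ u) → ∀ {x y} → WalkIn T S x y → label x ≡ label y
  label-walk avoid (here _) = refl
  label-walk avoid (step Sx (inj₁ e) w) =
    trans (sym (label-parent e (avoid Sx) (avoid (walk-start w)))) (label-walk avoid w)
  label-walk avoid (step Sx (inj₂ e) w) =
    trans (label-parent e (avoid (walk-start w)) (avoid Sx)) (label-walk avoid w)

-- Here c is a child of u whose subtree contains x: the climb from x meets c before the root, so x
-- is not in the component above c.
label-inside : ∀ T {u c x c'} → c ≢ u → c ≢ zero → Label T u x c → Label T c x c' → c' ≢ zero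
label-inside T c≢u c≢0 (at eq)  _ = contradiction eq c≢u
label-inside T c≢u c≢0 (root _) _ = contradiction refl c≢0
label-inside T c≢u c≢0 l@(child _) l' = λ c'≡0 → c≢0 (trans (label-unique T _ (at refl) l') c'≡0)
label-inside T c≢u c≢0 (climb _ _ l) (at _)          = λ ()
label-inside T c≢u c≢0 (climb _ _ l) (child _)       = λ ()
label-inside T c≢u c≢0 (climb _ _ l) (climb _ _ l')  = label-inside T c≢u c≢0 l l'

filter-disjoint : ∀ {A : Set} {P Q : A → Set} (P? : Decidable P) (Q? : Decidable Q) →
  (∀ {x} → P x → ¬ Q x) → ∀ xs → length (filter P? xs) + length (filter Q? xs) ≤ length xs
filter-disjoint P? Q? disjoint []       = z≤n
filter-disjoint P? Q? disjoint (x ∷ xs) with P? x | Q? x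
... | yes p | yes q = contradiction q (disjoint p)
... | yes _ | no _  = s≤s (filter-disjoint P? Q? disjoint xs)
... | no _  | yes _ = ≤-trans (≤-reflexive (+-suc _ _)) (s≤s (filter-disjoint P? Q? disjoint xs))
... | no _  | no _  = m≤n⇒m≤1+n (filter-disjoint P? Q? disjoint xs)

module _ (T : Tree) {A : Set} (home : A → Node T) (xs : List A) where

  part : Node T → Node T → List A
  part u c = filter (λ x → label T u (home x) ≟ c) xs

  weight : Node T → Node T → ℕ
  weight u c = length (part u c)

  Balanced : Node T → Set
  Balanced u = ∀ c → c ≢ u → weight u c + weight u c ≤ length xs

  -- Walk from the root towards an overweight component; the component above stays light.
  balanced-node : ∃ Balanced
  balanced-node = descend (suc (size T)) zero (m≤m+n _ 0) (λ 0≢0 → contradiction refl 0≢0)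
    where
    open ≤-Reasoning
    -- The first argument is fuel: the index of u grows with each move, so fuel plus index stays
    -- above the last index. The invariant on the component above u is vacuous at the root.
    descend : ∀ n u → suc (size T) ≤ n + toℕ u → (zero ≢ u → weight u zero + weight u zero ≤ length xs) → ∃ Balanced
    descend zero    u far _ = contradiction (toℕ<n u) (≤⇒≯ far)
    descend (suc n) u far above with any? (λ c → ¬? (c ≟ u) ×-dec (length xs <? weight u c + weight u c))
    ... | no none = u , λ c c≢u → ≮⇒≥ (λ heavy → none (c , c≢u , heavy))
    ... | yes (c , c≢u , heavy) = descend n c further above-c
      where
      c≢0 : c ≢ zero
      c≢0 refl = <⇒≱ heavy (above c≢u)
      occupied : ∀ ys → 0 < length (filter (λ x → label T u (home x) ≟ c) ys) → ∃ λ x → label T u (home x) ≡ c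
      occupied (y ∷ ys) lt with label T u (home y) ≟ c
      ... | yes eq = y , eq
      ... | no _   = occupied ys lt
      positive : 0 < weight u c
      positive = n≢0⇒n>0 λ eq → n≮0 (subst (λ w → length xs < w + w) eq heavy)
      u<c : toℕ u < toℕ c
      u<c with occupied xs positive
      ... | x , eq with label-range T u (subst (Label T u (home x)) eq (label⁺ T u (home x))) c≢u
      ...   | inj₁ c≡0 = contradiction c≡0 c≢0
      ...   | inj₂ lt  = lt
      further : suc (size T) ≤ n + toℕ c
      further = ≤-trans far (≤-trans (≤-reflexive (sym (+-suc n (toℕ u)))) (+-monoʳ-≤ n u<c))
      complementary : weight c zero + weight u c ≤ length xs
      complementary = filter-disjoint _ _ (λ {x} eq eq' →
        label-inside T c≢u c≢0 (subst (Label T u (home x)) eq' (label⁺ T u (home x))) (label⁺ T c (home x)) eq) xs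
      -- The component above c and the component of T - u named c are disjoint, so they cannot both
      -- hold more than half of `xs`.
      above-c : zero ≢ c → weight c zero + weight c zero ≤ length xs
      above-c _ = ≮⇒≥ λ lt → <⇒≱ (+-mono-< lt heavy) (begin
        (weight c zero + weight c zero) + (weight u c + weight u c)   ≡⟨ +-interchange (weight c zero) _ _ _ ⟩
        (weight c zero + weight u c) + (weight c zero + weight u c)   ≤⟨ +-mono-≤ complementary complementary ⟩
        length xs + length xs                                         ∎)

-- From separators to hypertree decompositions

module _ (H : Hypergraph) (k : ℕ) where

  private
    V = Fin (nV H)
    E = Fin (nE H)

  covered? : ∀ L → Decidable (Covered H L)
  covered? L v = map′ find (λ (_ , e∈ , v∈) → lose e∈ v∈) (Any.any? (λ e → v ∈? edge H e) L)

  covered-⊆ : ∀ {L L' v} → (∀ {e} → e ∈ˡ L → e ∈ˡ L') → Covered H L v → Covered H L' v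
  covered-⊆ L⊆ (e , e∈ , v∈) = e , L⊆ e∈ , v∈

  all-covered? : ∀ L e → (∀ {v} → v ∈ edge H e → Covered H L v) ⊎ ∃ λ v → v ∈ edge H e × ¬ Covered H L v
  all-covered? L e with any? (λ v → (v ∈? edge H e) ×-dec ¬? (covered? L v))
  ... | yes w   = inj₂ w
  ... | no none = inj₁ λ {v} v∈e → decidable-stable (covered? L v) (λ ¬cov → none (v , v∈e , ¬cov))

  -- What the recursion takes from a tree decomposition: outside the vertices covered by the
  -- separator no edge joins two parts, and each part sees at most k edges of M.
  record Separation (M : List E) : Set where
    field
      separator   : List E
      small       : length separator ≤ k
      parts       : ℕ
      partOf      : V → Fin parts
      edgesOf     : Fin parts → List E
      halves      : ∀ c → length (edgesOf c) ≤ k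
      separated   : ∀ {e v w} → v ∈ edge H e → w ∈ edge H e →
                    ¬ Covered H separator v → ¬ Covered H separator w → partOf v ≡ partOf w
      distributed : ∀ {e v} → e ∈ˡ M → v ∈ edge H e → ¬ Covered H separator v → e ∈ˡ edgesOf (partOf v)

  -- Rounding down lets 2k + 1 edges be halved to k, which makes room for one edge beyond the 2k of
  -- the boundary.
  half : ∀ a → a + a ≤ suc (k + k) → a ≤ k
  half a le = ≮⇒≥ λ k<a → <⇒≱ (≤-trans (s≤s (≤-reflexive (sym (+-suc k k)))) (+-mono-≤ k<a k<a)) le

  -- The separator covers the bag of a node u that balances the homes of the edges of M. An
  -- uncovered vertex is not in that bag, so all its bags, and the home of each edge through it, lie
  -- in one component of T - u.
  separation : (D : TreeDecomposition H) → (∀ u → ∃ λ S → length S ≤ k × Covers H S (bag D u)) →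
               ∀ M → length M ≤ suc (k + k) → Separation M
  separation D cov M M≤ = record
    { separator   = S
    ; small       = proj₁ (proj₂ (cov u))
    ; parts       = suc (size T)
    ; partOf      = partOf
    ; edgesOf     = edgesOf
    ; halves      = halves
    ; separated   = λ v∈ w∈ ¬v ¬w → trans (partOf-home v∈ ¬v) (sym (partOf-home w∈ ¬w))
    ; distributed = distributed
    }
    where
    T = tree D
    home : E → Node T
    home e = proj₁ (edge-bag D e)
    u = proj₁ (balanced-node T home M)
    S = proj₁ (cov u)
    avoids : ∀ {v} → ¬ Covered H S v → ∀ {x} → v ∈ bag D x → x ≢ u
    avoids ¬v v∈ refl = ¬v (proj₂ (proj₂ (cov u)) _ v∈)
    inBag? : ∀ v → Dec (∃ λ x → v ∈ bag D x)
    inBag? v = any? (λ x → v ∈? bag D x)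
    partOf : V → Node T
    partOf v with inBag? v
    ... | yes (x , _) = label T u x
    -- A vertex in no bag lies on no edge, so its part is arbitrary.
    ... | no _        = zero
    partOf-home : ∀ {e v} → v ∈ edge H e → ¬ Covered H S v → partOf v ≡ label T u (home e)
    partOf-home {e} {v} v∈e ¬v with inBag? v
    ... | yes (x , v∈x) = label-walk T u (avoids ¬v) (connected D v x (home e) v∈x (proj₂ (edge-bag D e) v∈e))
    ... | no none       = contradiction (home e , proj₂ (edge-bag D e) v∈e) none
    edgesOf : Node T → List E
    edgesOf c with c ≟ u
    -- `Balanced` bounds no weight at u itself, but an edge with home u lies wholly within the
    -- vertices covered by the separator.
    ... | yes _ = []
    ... | no _  = part T home M u c
    halves : ∀ c → length (edgesOf c) ≤ k
    halves c with c ≟ u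
    ... | yes _  = z≤n
    ... | no c≢u = half _ (≤-trans (proj₂ (balanced-node T home M) c c≢u) M≤)
    distributed : ∀ {e v} → e ∈ˡ M → v ∈ edge H e → ¬ Covered H S v → e ∈ˡ edgesOf (partOf v)
    distributed {e} {v} e∈ v∈ ¬v with partOf v | partOf-home v∈ ¬v
    ... | c | eq with c ≟ u
    ...   | no _    = ∈-filter⁺ (λ e → label T u (home e) ≟ c) e∈ (sym eq)
    ...   | yes c≡u = contradiction (trans (sym eq) c≡u)
                        (label-≢ T u (label⁺ T u (home e)) (avoids ¬v (proj₂ (edge-bag D e) v∈)))

  -- Recursive decomposition of pieces

  Touches : Subset (nV H) → E → Set
  Touches C e = ∃ λ v → v ∈ edge H e × v ∈ C

  touches? : ∀ C → Decidable (Touches C)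
  touches? C e = any? (λ v → (v ∈? edge H e) ×-dec (v ∈? C))

  -- The vertices of C that lie on edges, together with the boundary of C.
  Near : Subset (nV H) → V → Set
  Near C v = ∃ λ e → v ∈ edge H e × Touches C e

  near? : ∀ C → Decidable (Near C)
  near? C v = any? (λ e → (v ∈? edge H e) ×-dec touches? C e)

  Closed : Subset (nV H) → List E → Set
  Closed C M = ∀ {e v} → Touches C e → v ∈ edge H e → v ∈ C ⊎ Covered H M v

  module _ (separate : ∀ M → length M ≤ suc (k + k) → Separation M) where

    private
      width-bound : ℕ
      width-bound = suc (k + k) + k

    open Fragment using (bag)

    -- `inside` confines a fragment to its piece and boundary, so that pieces can be glued;
    -- `attached` puts the boundary into the root bag, where the fragment meets its parent;
    -- `complete` accounts for the edges that meet C.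
    record Decomposes (C : Subset (nV H)) (M : List E) : Set where
      field
        fragment : Fragment H width-bound
        inside   : ∀ {v} → Occurs H fragment v → Near C v
        attached : ∀ {v} → Near C v → Covered H M v → v ∈ rootBag H fragment
        complete : ∀ {e} → Touches C e → ∃ λ u → edge H e ⊆ bag fragment u
    open Decomposes

    module _ (C : Subset (nV H)) (M₀ : List E) (M₀≤ : length M₀ ≤ k + k) (closed : Closed C M₀)
             (f : E) (w : V) (w∈f : w ∈ edge H f) (w∈C : w ∈ C)
             (rec : ∀ C′ M′ → ∣ C′ ∣ < ∣ C ∣ → length M′ ≤ k + k → Closed C′ M′ → Decomposes C′ M′) where

      private
        -- The edge f covers the vertex w of C, so every sub-piece is smaller than C.
        M = f ∷ M₀
        open Separation (separate M (s≤s M₀≤))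
        L = M ++ separator
        -- The root bag takes every vertex near C that L covers, so the special condition holds
        -- there by construction.
        inB? : Decidable (λ v → Covered H L v × Near C v)
        inB? v = covered? L v ×-dec near? C v
        B = comprehension inB?
        M₀⊆L : ∀ {v} → Covered H M₀ v → Covered H L v
        M₀⊆L = covered-⊆ (∈-++⁺ˡ ∘ there)
        S⊆L : ∀ {v} → Covered H separator v → Covered H L v
        S⊆L = covered-⊆ (∈-++⁺ʳ M)
        inPart? : ∀ c → Decidable (λ v → v ∈ C × ¬ Covered H L v × partOf v ≡ c)
        inPart? c v = (v ∈? C) ×-dec ¬? (covered? L v) ×-dec (partOf v ≟ c)
        sub : Fin parts → Subset (nV H)
        sub c = comprehension (inPart? c)
        sub⁻ : ∀ {c v} → v ∈ sub c → v ∈ C × ¬ Covered H L v × partOf v ≡ c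
        sub⁻ {c} = ∈-comprehension⁻ (inPart? c)
        subEdges : Fin parts → List E
        subEdges c = separator ++ edgesOf c
        touches-sub : ∀ {c e} → Touches (sub c) e → Touches C e
        touches-sub (v , v∈e , v∈) = v , v∈e , proj₁ (sub⁻ v∈)
        near-sub : ∀ {c v} → Near (sub c) v → Near C v
        near-sub (e , v∈e , t) = e , v∈e , touches-sub t
        sub-smaller : ∀ c → ∣ sub c ∣ < ∣ C ∣
        sub-smaller c = p⊂q⇒∣p∣<∣q∣ ((λ v∈ → proj₁ (sub⁻ v∈)) , w , w∈C , λ w∈ →
          proj₁ (proj₂ (sub⁻ w∈)) (f , here refl , w∈f))
        same-part : ∀ {c e v} → Touches (sub c) e → v ∈ edge H e → ¬ Covered H separator v → partOf v ≡ c
        same-part (x , x∈e , x∈) v∈e ¬v with sub⁻ x∈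
        ... | _ , ¬x , eq = trans (separated v∈e x∈e ¬v (¬x ∘ S⊆L)) eq
        -- A vertex v on an edge meeting the sub-piece is covered by the separator, or is uncovered
        -- by L and then lies in the sub-piece itself, or is covered by an edge of M but not by the
        -- separator; `distributed` assigns that edge to part c.
        sub-closed : ∀ c → Closed (sub c) (subEdges c)
        sub-closed c {e} {v} t v∈e with covered? separator v
        ... | yes covS = inj₂ (covered-⊆ ∈-++⁺ˡ covS)
        ... | no ¬S with covered? L v
        ...   | no ¬L = inj₁ (∈-comprehension⁺ (inPart? c) (v∈C , ¬L , same-part t v∈e ¬S))
          where
          v∈C : v ∈ C
          v∈C with closed (touches-sub t) v∈e
          ... | inj₁ v∈C = v∈C
          ... | inj₂ cov = contradiction (M₀⊆L cov) ¬L
        ...   | yes (e' , e'∈ , v∈e') with ∈-++⁻ M e'∈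
        ...     | inj₂ e'∈S = contradiction (e' , e'∈S , v∈e') ¬S
        ...     | inj₁ e'∈M = inj₂ (e' , ∈-++⁺ʳ separator
                    (subst (λ c → e' ∈ˡ edgesOf c) (same-part t v∈e ¬S) (distributed e'∈M v∈e' ¬S)) , v∈e')
        part-decomposes : ∀ c → Decomposes (sub c) (subEdges c)
        part-decomposes c = rec (sub c) (subEdges c) (sub-smaller c)
          (≤-trans (≤-reflexive (length-++ separator)) (+-mono-≤ small (halves c))) (sub-closed c)
        G : Fin parts → Fragment H width-bound
        G c = fragment (part-decomposes c)
        -- A vertex covered by L is in no sub-piece, so if it occurs in `G c` it is on the boundary,
        -- which `attached` places in the root bag.
        rooted : ∀ c v → Occurs H (G c) v → v ∈ B → v ∈ rootBag H (G c)
        rooted c v o v∈B with inside (part-decomposes c) o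
        ... | near@(e , v∈e , t) with sub-closed c t v∈e
        ...   | inj₁ v∈sub = contradiction (proj₁ (∈-comprehension⁻ inB? v∈B)) (proj₁ (proj₂ (sub⁻ v∈sub)))
        ...   | inj₂ cov   = attached (part-decomposes c) near cov
        above : ∀ c v → Covered H L v → Occurs H (G c) v → v ∈ B
        above c v cov o = ∈-comprehension⁺ inB? (cov , near-sub (inside (part-decomposes c) o))
        keyed : ∀ c v → Occurs H (G c) v → v ∉ B → partOf v ≡ c
        keyed c v o v∉B with inside (part-decomposes c) o
        ... | e , v∈e , t = same-part t v∈e (λ cov → v∉B (above c v (S⊆L cov) o))
        L≤ : length L ≤ width-bound
        L≤ = ≤-trans (≤-reflexive (length-++ M)) (+-mono-≤ (s≤s M₀≤) small)
        B-covered : ∀ v → v ∈ B → Covered H L v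
        B-covered v v∈ = proj₁ (∈-comprehension⁻ inB? v∈)

        module _ (A : Assembled H B L B-covered L≤ G partOf rooted keyed above (allFin parts)) where
          open Assembled A

          inside′ : ∀ {v} → Occurs H whole v → Near C v
          inside′ o with occurs o
          ... | inj₁ v∈B           = proj₂ (∈-comprehension⁻ inB? v∈B)
          ... | inj₂ (c , _ , o')  = near-sub (inside (part-decomposes c) o')
          complete-part : ∀ {e v} → v ∈ edge H e → ¬ Covered H L v → v ∈ C → ∃ λ u → edge H e ⊆ bag whole u
          complete-part {e} {v} v∈e ¬cov v∈C =
            let v∈sub  = ∈-comprehension⁺ (inPart? (partOf v)) (v∈C , ¬cov , refl)
                x , e⊆ = complete (part-decomposes (partOf v)) (v , v∈e , v∈sub)
                u , eq = contains (∈-allFin (partOf v)) x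
            in u , λ {v′} v′∈ → subst (v′ ∈_) (sym eq) (e⊆ v′∈)

          complete-root : ∀ {e} → Touches C e → (∀ {v} → v ∈ edge H e → Covered H L v) → edge H e ⊆ rootBag H whole
          complete-root {e} t cov {v} v∈e = subst (v ∈_) (sym root-bag) (∈-comprehension⁺ inB? (cov v∈e , e , v∈e , t))

          -- An edge covered by L fits in the root bag. Otherwise it has an uncovered vertex; as
          -- `M₀` covers the boundary, that vertex lies in C, hence in a sub-piece whose fragment
          -- holds the edge.
          complete′ : ∀ {e} → Touches C e → ∃ λ u → edge H e ⊆ bag whole u
          complete′ {e} t = [ at-root , below-root ]′ (all-covered? L e)
            where
            at-root : (∀ {v} → v ∈ edge H e → Covered H L v) → ∃ λ u → edge H e ⊆ bag whole u
            at-root cov = zero , complete-root t cov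
            below-root : (∃ λ v → v ∈ edge H e × ¬ Covered H L v) → ∃ λ u → edge H e ⊆ bag whole u
            below-root (v , v∈e , ¬cov) =
              [ complete-part v∈e ¬cov , (λ cov → contradiction (M₀⊆L cov) ¬cov) ]′ (closed t v∈e)

          decomposed : Decomposes C M₀
          decomposed = record
            { fragment = whole
            ; inside   = inside′
            ; attached = λ near cov → subst (_ ∈_) (sym root-bag) (∈-comprehension⁺ inB? (M₀⊆L cov , near))
            ; complete = complete′
            }

      decompose-step : Decomposes C M₀
      decompose-step = decomposed (assemble H B L B-covered L≤ G partOf rooted keyed above (Unique.allFin⁺ parts))

    decompose : ∀ n C M → ∣ C ∣ < n → length M ≤ k + k → Closed C M → Decomposes C M
    decompose (suc n) C M C<n M≤ closed with any? (touches? C)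
    -- No edge meets C, so no vertex is near it and a single empty bag satisfies every clause.
    ... | no untouched = record
      { fragment = singleton H ⊥ [] (λ _ v∈ → contradiction v∈ ∉⊥) z≤n
      ; inside   = λ (_ , v∈) → contradiction v∈ ∉⊥
      ; attached = λ (e , _ , t) _ → contradiction (e , t) untouched
      ; complete = λ {e} t → contradiction (e , t) untouched
      }
    ... | yes (f , w , w∈f , w∈C) = decompose-step C M M≤ closed f w w∈f w∈C
      λ C′ M′ C′<C → decompose n C′ M′ (<-≤-trans C′<C (s≤s⁻¹ C<n))

    module _ (D : Decomposes ⊤ []) where

      private module F = Fragment (fragment D)

      decomposes⇒hw≤ : hw≤ H width-bound
      decomposes⇒hw≤ = record
        { tree      = F.tree
        ; bag       = F.bag
        ; cover     = setOf ∘ F.cover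
        ; connected = F.connected
        ; edge-bag  = edge-bag′
        ; bag-cov   = λ u v v∈ → let e , e∈ , v∈e = F.bag-cov u v v∈ in e , ∈-setOf⁺ e∈ , v∈e
        ; special   = λ u v (e , e∈ , v∈e) (x , d , v∈) → F.special u v (e , ∈-setOf⁻ (F.cover u) e∈ , v∈e) d v∈
        } , λ u → ≤-trans (∣setOf∣≤ (F.cover u)) (F.width u)
        where
        edge-bag′ : ∀ e → ∃ λ u → edge H e ⊆ F.bag u
        edge-bag′ e with touches? ⊤ e
        ... | yes t = complete D t
        -- An edge that meets no vertex at all is empty and lies in any bag.
        ... | no ¬t = zero , λ v∈ → contradiction (_ , v∈ , ∈⊤) ¬t

    hypertree-width-bound : hw≤ H width-bound
    hypertree-width-bound = decomposes⇒hw≤ (decompose (suc ∣ ⊤ {nV H} ∣) ⊤ [] ≤-refl z≤n (λ _ _ → inj₁ ∈⊤))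

theorem3 : (𝓗 : Class) → UnboundedHw 𝓗 → BoundedFhw 𝓗 → Exotic 𝓗
theorem3 𝓗 unbounded (c , fhw) n _
  -- This is 3k + 1 for k = `coverBound n c`. Without n shattered vertices every bag would have a
  -- cover by k edges, and the hypertree width would not exceed it.
  with unbounded (suc (coverBound n c + coverBound n c) + coverBound n c)
... | H , H∈ , ¬hw = H , H∈ , shattered⇒induced H n (decidable-stable (shattered? H n) λ ¬shattered →
  let D , frac = fhw H H∈ in
  ¬hw (hypertree-width-bound H (coverBound n c)
    (separation H (coverBound n c) D λ u → small-cover n c H (bag D u) ¬shattered (frac u))))
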